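{- Let $\rho$ and $\sigma$ be highest weights of irreducible representations $V$ and $W$ of $\mathrm{GL}(g)$, respectively. Let $f$ be a modular form of weight $\rho$, i.e. a section of $\mathbb{E}_\rho$ over $X$, and let $I$ be a concomitant of type $(d,\sigma)$ for the action of $\mathrm{GL}(g)$ on $V$, given by a $\mathrm{GL}(g)$-equivariant embedding $\phi: W\hookrightarrow \mathrm{Sym}^d(V)$. Then applying $I$ to $f$ yields a modular form of weight $\sigma$, i.e. a section of $\mathbb{E}_\sigma$ over $X$.
   Context: Setting: $X$ is a complex analytic space (or orbifold or stack), for instance an arithmetic quotient of a bounded symmetric domain or a moduli space of abelian varieties or of curves (or a compactification of it to which the Hodge bundle extends), carrying a holomorphic vector bundle $\mathbb{E}$ of rank $g$ (the Hodge bundle). For an irreducible (finite-dimensional, rational, complex) representation $V$ of $\mathrm{GL}(g)$ of highest weight $\rho$, $\mathbb{E}_\rho$ denotes the vector bundle on $X$ obtained from $\mathbb{E}$ by the Schur functor defined by $\rho$, that is, the bundle with fibre $V$ associated with the frame bundle of $\mathbb{E}$ via the representation $V$. A modular form of weight $\rho$ is a holomorphic section of $\mathbb{E}_\rho$ over $X$. (On a quotient $\Gamma\backslash D$ of a bounded symmetric domain $D$ on which $\mathbb{E}$ is given by a factor of automorphy $j:\Gamma\times D\to \mathrm{GL}(g,\mathbb{C})$, such a section is a holomorphic function $f:D\to V$ with $f(\gamma z)=\rho(j(\gamma,z))f(z)$ for all $\gamma\in\Gamma$, $z\in D$.) A concomitant of type $(d,\sigma)$ for $\rho$ is given by a $\mathrm{GL}(g)$-equivariant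 embedding $\phi:W\hookrightarrow \mathrm{Sym}^d(V)$, where $W$ is the irreducible representation of $\mathrm{GL}(g)$ of highest weight $\sigma$. (The case where $W=\det(U)^{\otimes m}$, with $U$ the standard representation, is that of an invariant.) Applying the concomitant to $f$ means the following: $\mathrm{Sym}^d(f)$ is the section $f^d$ of $\mathrm{Sym}^d(\mathbb{E}_\rho)$, and one projects it to $\mathbb{E}_\sigma$, viewed as a direct summand of $\mathrm{Sym}^d(\mathbb{E}_\rho)$ via $\phi$; that is, one takes the image of $f^d$ under the bundle map $\mathrm{Sym}^d(\mathbb{E}_\rho)\to\mathbb{E}_\sigma$ induced by a $\mathrm{GL}(g)$-equivariant projection $p:\mathrm{Sym}^d(V)\to W$ with $p\circ\phi=\mathrm{id}_W$. -}

module Defs where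

open import Level using (0ℓ)
open import Data.Fin.Base using (Fin; zero; suc) renaming (_<_ to _<ᶠ_)
open import Data.Fin.Permutation using (Permutation′; _⟨$⟩ʳ_)
open import Data.Fin.Properties using () renaming (_≟_ to _≟ᶠ_)
open import Data.Integer.Base using (ℤ; +_; -[1+_])
open import Data.List.Base as List using (List; []; _∷_; _++_)
import Data.List.Properties as List
open import Data.Nat.Base as ℕ using (ℕ; zero; suc)
import Data.Nat.Properties as ℕ
open import Data.Product using (Σ-syntax; ∃-syntax; _×_; _,_; proj₁; proj₂; map₁; map₂)
open import Data.Rational.Base as ℚ using (ℚ; 0ℚ; 1ℚ; ½; ∣_∣; 1/_)
import Data.Rational.Properties as ℚ
open import Data.Rational.Solver using (module +-*-Solver)
open import Data.Sum.Base using (inj₁; inj₂)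
open import Data.Unit.Base using (⊤)
import Data.Vec.Functional as Vector
open import Function.Base using (_∘_; id)
open import Relation.Binary.Bundles using (Setoid)
open import Relation.Binary.PropositionalEquality as ≡ using (_≡_; _≢_)
import Relation.Binary.Reasoning.Setoid as SetoidReasoning
open import Relation.Nullary using (yes; no)
open import Algebra.Bundles using (CommutativeRing)
open import Algebra.Module.Bundles using (Module)
open import Algebra.Module.Morphism.Structures using (module ModuleMorphisms)
open import Algebra.Module.Structures.Biased using (IsModuleFromLeft)
open import Algebra.Morphism.Structures using (module RingMorphisms)
import Algebra.Morphism.Construct.Composition as Composition
import Algebra.Morphism.Construct.Identity as Identity
import Algebra.Properties.CommutativeMonoid.Sum as CommutativeMonoidSum
import Algebra.Properties.Semiring.Exp as Exp
import Algebra.Properties.Semiring.Sum as Sum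

Null : (ℕ → ℚ) → Set
Null a = ∀ ε → 0ℚ ℚ.< ε → ∃[ N ] ∀ n → N ℕ.≤ n → ∣ a n ∣ ℚ.≤ ε

IsCauchy : (ℕ → ℚ) → Set
IsCauchy a = ∀ ε → 0ℚ ℚ.< ε → ∃[ N ] ∀ m n → N ℕ.≤ m → N ℕ.≤ n → ∣ a m ℚ.- a n ∣ ℚ.≤ ε

Bounded : (ℕ → ℚ) → Set
Bounded a = ∃[ B ] (0ℚ ℚ.< B × ∀ n → ∣ a n ∣ ℚ.≤ B)

record ℝ : Set where
  constructor mkℝ
  field
    seq    : ℕ → ℚ
    cauchy : IsCauchy seq
open ℝ

infix 4 _≈ᵣ_
record _≈ᵣ_ (x y : ℝ) : Set where
  constructor mk≈ᵣ
  field null : Null (λ n → seq x n ℚ.- seq y n)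
open _≈ᵣ_

module RealLemmas where
  open +-*-Solver

  0<½ : 0ℚ ℚ.< ½
  0<½ = ℚ.positive⁻¹ ½

  opaque
    half : ∀ ε → 0ℚ ℚ.< ε → ∃[ δ ] (0ℚ ℚ.< δ × δ ℚ.+ δ ≡ ε)
    half ε 0<ε = ε ℚ.* ½
      , ≡.subst (ℚ._< ε ℚ.* ½) (ℚ.*-zeroˡ ½) (ℚ.*-monoˡ-<-pos ½ 0<ε)
      , ≡.trans (≡.sym (ℚ.*-distribˡ-+ ε ½ ½)) (ℚ.*-identityʳ ε)

    shrink : ∀ ε B → 0ℚ ℚ.< ε → 0ℚ ℚ.< B → ∃[ δ ] (0ℚ ℚ.< δ × B ℚ.* δ ≡ ε)
    shrink ε B 0<ε 0<B = ε ℚ.* (1/ B)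
      , ≡.subst (ℚ._< ε ℚ.* 1/ B) (ℚ.*-zeroˡ (1/ B)) (ℚ.*-monoˡ-<-pos (1/ B) 0<ε)
      , (begin
          B ℚ.* (ε ℚ.* 1/ B)   ≡⟨ solve 3 (λ b e i → b :* (e :* i) := e :* (b :* i)) ≡.refl B ε (1/ B) ⟩
          ε ℚ.* (B ℚ.* 1/ B)   ≡⟨ ≡.cong (ε ℚ.*_) (ℚ.*-inverseʳ B) ⟩
          ε ℚ.* 1ℚ             ≡⟨ ℚ.*-identityʳ ε ⟩
          ε                    ∎)
      where
        open ≡.≡-Reasoning
        instance
          posB : ℚ.Positive B
          posB = ℚ.positive 0<B
          nzB : ℚ.NonZero B
          nzB = ℚ.pos⇒nonZero B
          pos1/B : ℚ.Positive (1/ B)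
          pos1/B = ℚ.1/pos⇒pos B

  null-cong : ∀ {a b} → (∀ n → a n ≡ b n) → Null a → Null b
  null-cong eq na ε 0<ε with na ε 0<ε
  ... | N , h = N , λ n N≤n → ≡.subst (λ q → ∣ q ∣ ℚ.≤ ε) (eq n) (h n N≤n)

  null-0 : ∀ {a} → (∀ n → a n ≡ 0ℚ) → Null a
  null-0 eq ε 0<ε = 0 , λ n _ → ≡.subst (λ q → ∣ q ∣ ℚ.≤ ε) (≡.sym (eq n)) (ℚ.<⇒≤ 0<ε)

  null-neg : ∀ {a} → Null a → Null (λ n → ℚ.- a n)
  null-neg {a} na ε 0<ε with na ε 0<ε
  ... | N , h = N , λ n N≤n → ≡.subst (ℚ._≤ ε) (≡.sym (ℚ.∣-p∣≡∣p∣ (a n))) (h n N≤n)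

  null-+ : ∀ {a b} → Null a → Null b → Null (λ n → a n ℚ.+ b n)
  null-+ {a} {b} na nb ε 0<ε with half ε 0<ε
  ... | δ , 0<δ , eq with na δ 0<δ | nb δ 0<δ
  ... | M , f | N , g = M ℕ.⊔ N , λ n le → ℚ.≤-trans (ℚ.∣p+q∣≤∣p∣+∣q∣ (a n) (b n))
      (≡.subst (∣ a n ∣ ℚ.+ ∣ b n ∣ ℚ.≤_) eq
        (ℚ.+-mono-≤ (f n (ℕ.≤-trans (ℕ.m≤m⊔n M N) le)) (g n (ℕ.≤-trans (ℕ.m≤n⊔m M N) le))))

  bounded-≤ : ∀ b a B δ ε → ∣ b ∣ ℚ.≤ B → ∣ a ∣ ℚ.≤ δ → 0ℚ ℚ.< B → B ℚ.* δ ≡ ε →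
              ∣ b ℚ.* a ∣ ℚ.≤ ε
  bounded-≤ b a B δ ε b≤B a≤δ 0<B eq = begin
      ∣ b ℚ.* a ∣      ≡⟨ ℚ.∣p*q∣≡∣p∣*∣q∣ b a ⟩
      ∣ b ∣ ℚ.* ∣ a ∣  ≤⟨ ℚ.*-monoʳ-≤-nonNeg ∣ a ∣ {{ℚ.∣-∣-nonNeg a}} b≤B ⟩
      B ℚ.* ∣ a ∣      ≤⟨ ℚ.*-monoˡ-≤-nonNeg B {{ℚ.nonNegative (ℚ.<⇒≤ 0<B)}} a≤δ ⟩
      B ℚ.* δ          ≡⟨ eq ⟩
      ε                ∎
    where open ℚ.≤-Reasoning

  null-* : ∀ {a b} → Bounded b → Null a → Null (λ n → b n ℚ.* a n)
  null-* {a} {b} (B , 0<B , b≤B) na ε 0<ε with shrink ε B 0<ε 0<B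
  ... | δ , 0<δ , eq with na δ 0<δ
  ... | N , h = N , λ n N≤n → bounded-≤ (b n) (a n) B δ ε (b≤B n) (h n N≤n) 0<B eq

  maxUpTo : (ℕ → ℚ) → ℕ → ℚ
  maxUpTo a zero    = ∣ a 0 ∣
  maxUpTo a (suc N) = maxUpTo a N ℚ.⊔ ∣ a (suc N) ∣

  ≤maxUpTo : ∀ a N n → n ℕ.≤ N → ∣ a n ∣ ℚ.≤ maxUpTo a N
  ≤maxUpTo a zero    zero _ = ℚ.≤-refl
  ≤maxUpTo a (suc N) n n≤1+N with ℕ.m≤n⇒m<n∨m≡n n≤1+N
  ... | inj₁ (ℕ.s≤s n≤N) = ℚ.≤-trans (≤maxUpTo a N n n≤N) (ℚ.p≤p⊔q _ _)
  ... | inj₂ ≡.refl = ℚ.p≤q⊔p (maxUpTo a N) _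

  opaque
    cauchy⇒bounded : ∀ {a} → IsCauchy a → Bounded a
    cauchy⇒bounded {a} ca with ca 1ℚ (ℚ.positive⁻¹ 1ℚ)
    ... | N , h = M ℚ.+ 1ℚ , 0<B , bound
      where
        open ℚ.≤-Reasoning
        M : ℚ
        M = maxUpTo a N
        0≤M : 0ℚ ℚ.≤ M
        0≤M = ℚ.≤-trans (ℚ.0≤∣p∣ (a N)) (≤maxUpTo a N N ℕ.≤-refl)
        0<B : 0ℚ ℚ.< M ℚ.+ 1ℚ
        0<B = ℚ.+-mono-≤-< 0≤M (ℚ.positive⁻¹ 1ℚ)
        bound : ∀ n → ∣ a n ∣ ℚ.≤ M ℚ.+ 1ℚ
        bound n with ℕ.≤-total n N
        ... | inj₁ n≤N = ℚ.≤-trans (≤maxUpTo a N n n≤N)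
                (≡.subst (ℚ._≤ M ℚ.+ 1ℚ) (ℚ.+-identityʳ M) (ℚ.+-monoʳ-≤ M (ℚ.<⇒≤ (ℚ.positive⁻¹ 1ℚ))))
        ... | inj₂ N≤n = begin
                ∣ a n ∣ ≡⟨ ≡.cong ∣_∣ (solve 2 (λ x y → x := y :+ (x :- y)) ≡.refl (a n) (a N)) ⟩
                ∣ a N ℚ.+ (a n ℚ.- a N) ∣      ≤⟨ ℚ.∣p+q∣≤∣p∣+∣q∣ (a N) _ ⟩
                ∣ a N ∣ ℚ.+ ∣ a n ℚ.- a N ∣    ≤⟨ ℚ.+-mono-≤ (≤maxUpTo a N N ℕ.≤-refl) (h n N N≤n ℕ.≤-refl) ⟩
                M ℚ.+ 1ℚ                       ∎

  opaque
    cauchy-const : ∀ q → IsCauchy (λ _ → q)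
    cauchy-const q ε 0<ε = 0 , λ _ _ _ _ →
      ≡.subst (λ r → ∣ r ∣ ℚ.≤ ε) (≡.sym (ℚ.+-inverseʳ q)) (ℚ.<⇒≤ 0<ε)

    cauchy-neg : ∀ {a} → IsCauchy a → IsCauchy (λ n → ℚ.- a n)
    cauchy-neg {a} ca ε 0<ε with ca ε 0<ε
    ... | N , h = N , λ m n p q → ≡.subst (ℚ._≤ ε)
      (≡.trans (≡.sym (ℚ.∣-p∣≡∣p∣ (a m ℚ.- a n)))
        (≡.cong ∣_∣ (solve 2 (λ x y → :- (x :- y) := (:- x) :- (:- y)) ≡.refl (a m) (a n))))
      (h m n p q)

    cauchy-+ : ∀ {a b} → IsCauchy a → IsCauchy b → IsCauchy (λ n → a n ℚ.+ b n)
    cauchy-+ {a} {b} ca cb ε 0<ε with half ε 0<ε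
    ... | δ , 0<δ , eq with ca δ 0<δ | cb δ 0<δ
    ... | M , f | N , g = M ℕ.⊔ N , λ m n p q → begin
        ∣ (a m ℚ.+ b m) ℚ.- (a n ℚ.+ b n) ∣
          ≡⟨ ≡.cong ∣_∣ (solve 4 (λ x y z w → (x :+ y) :- (z :+ w) := (x :- z) :+ (y :- w)) ≡.refl (a m) (b m) (a n) (b n)) ⟩
        ∣ (a m ℚ.- a n) ℚ.+ (b m ℚ.- b n) ∣   ≤⟨ ℚ.∣p+q∣≤∣p∣+∣q∣ (a m ℚ.- a n) _ ⟩
        ∣ a m ℚ.- a n ∣ ℚ.+ ∣ b m ℚ.- b n ∣
          ≤⟨ ℚ.+-mono-≤ (f m n (ℕ.≤-trans (ℕ.m≤m⊔n M N) p) (ℕ.≤-trans (ℕ.m≤m⊔n M N) q))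
                        (g m n (ℕ.≤-trans (ℕ.m≤n⊔m M N) p) (ℕ.≤-trans (ℕ.m≤n⊔m M N) q)) ⟩
        δ ℚ.+ δ                               ≡⟨ eq ⟩
        ε                                     ∎
      where open ℚ.≤-Reasoning

    cauchy-* : ∀ {a b} → IsCauchy a → IsCauchy b → IsCauchy (λ n → a n ℚ.* b n)
    cauchy-* {a} {b} ca cb ε 0<ε
      with half ε 0<ε | cauchy⇒bounded ca | cauchy⇒bounded cb
    ... | δ , 0<δ , eq | A , 0<A , a≤A | B , 0<B , b≤B
      with shrink δ A 0<δ 0<A | shrink δ B 0<δ 0<B
    ... | α , 0<α , eqα | β , 0<β , eqβ
      with ca β 0<β | cb α 0<α
    ... | M , f | N , g = M ℕ.⊔ N , λ m n p q → begin
        ∣ a m ℚ.* b m ℚ.- a n ℚ.* b n ∣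
          ≡⟨ ≡.cong ∣_∣ (solve 4 (λ x y z w → x :* y :- z :* w := y :* (x :- z) :+ z :* (y :- w)) ≡.refl (a m) (b m) (a n) (b n)) ⟩
        ∣ b m ℚ.* (a m ℚ.- a n) ℚ.+ a n ℚ.* (b m ℚ.- b n) ∣
          ≤⟨ ℚ.∣p+q∣≤∣p∣+∣q∣ (b m ℚ.* (a m ℚ.- a n)) _ ⟩
        ∣ b m ℚ.* (a m ℚ.- a n) ∣ ℚ.+ ∣ a n ℚ.* (b m ℚ.- b n) ∣
          ≤⟨ ℚ.+-mono-≤
               (bounded-≤ (b m) _ B β δ (b≤B m) (f m n (ℕ.≤-trans (ℕ.m≤m⊔n M N) p) (ℕ.≤-trans (ℕ.m≤m⊔n M N) q)) 0<B eqβ)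
               (bounded-≤ (a n) _ A α δ (a≤A n) (g m n (ℕ.≤-trans (ℕ.m≤n⊔m M N) p) (ℕ.≤-trans (ℕ.m≤n⊔m M N) q)) 0<A eqα) ⟩
        δ ℚ.+ δ ≡⟨ eq ⟩
        ε       ∎
      where open ℚ.≤-Reasoning

  ≗⇒≈ᵣ : ∀ {x y} → (∀ n → seq x n ≡ seq y n) → x ≈ᵣ y
  ≗⇒≈ᵣ {x} {y} eq = mk≈ᵣ (null-0 λ n →
    ≡.trans (≡.cong (ℚ._- seq y n) (eq n)) (ℚ.+-inverseʳ (seq y n)))

open RealLemmas

infixl 6 _+ᵣ_
infixl 7 _*ᵣ_
_+ᵣ_ _*ᵣ_ : ℝ → ℝ → ℝ
x +ᵣ y = mkℝ (λ n → seq x n ℚ.+ seq y n) (cauchy-+ {seq x} {seq y} (cauchy x) (cauchy y))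
x *ᵣ y = mkℝ (λ n → seq x n ℚ.* seq y n) (cauchy-* {seq x} {seq y} (cauchy x) (cauchy y))

-ᵣ_ : ℝ → ℝ
-ᵣ x = mkℝ (λ n → ℚ.- seq x n) (cauchy-neg {seq x} (cauchy x))

fromℚ : ℚ → ℝ
fromℚ q = mkℝ (λ _ → q) (cauchy-const q)

infix 4 _<ᵣ_ _≤ᵣ_
_<ᵣ_ _≤ᵣ_ : ℝ → ℝ → Set
x <ᵣ y = ∃[ ε ] (0ℚ ℚ.< ε × ∃[ N ] ∀ n → N ℕ.≤ n → seq x n ℚ.+ ε ℚ.≤ seq y n)
x ≤ᵣ y = ∀ ε → 0ℚ ℚ.< ε → ∃[ N ] ∀ n → N ℕ.≤ n → seq x n ℚ.≤ seq y n ℚ.+ ε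

ℝ-commutativeRing : CommutativeRing 0ℓ 0ℓ
ℝ-commutativeRing = record
  { Carrier = ℝ ; _≈_ = _≈ᵣ_ ; _+_ = _+ᵣ_ ; _*_ = _*ᵣ_ ; -_ = -ᵣ_
  ; 0# = fromℚ 0ℚ ; 1# = fromℚ 1ℚ
  ; isCommutativeRing = record
    { isRing = record
      { +-isAbelianGroup = record
        { isGroup = record
          { isMonoid = record
            { isSemigroup = record
              { isMagma = record
                { isEquivalence = record
                  { refl  = λ {x} → ≗⇒≈ᵣ {x} {x} λ _ → ≡.refl
                  ; sym   = λ {x} {y} p → mk≈ᵣ (null-cong (λ n → solve 2 (λ a b → :- (a :- b) := b :- a) ≡.refl (seq x n) (seq y n)) (null-neg (null p)))
                  ; trans = λ {x} {y} {z} p q → mk≈ᵣ (null-cong (λ n → solve 3 (λ a b c → (a :- b) :+ (b :- c) := a :- c) ≡.refl (seq x n) (seq y n) (seq z n)) (null-+ (null p) (null q)))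
                  }
                ; ∙-cong = λ {x} {y} {u} {v} p q → mk≈ᵣ (null-cong (λ n → solve 4 (λ a b c d → (a :- b) :+ (c :- d) := (a :+ c) :- (b :+ d)) ≡.refl (seq x n) (seq y n) (seq u n) (seq v n)) (null-+ (null p) (null q)))
                }
              ; assoc = λ x y z → ≗⇒≈ᵣ {(x +ᵣ y) +ᵣ z} {x +ᵣ (y +ᵣ z)} λ n → ℚ.+-assoc (seq x n) (seq y n) (seq z n)
              }
            ; identity = (λ x → ≗⇒≈ᵣ {fromℚ 0ℚ +ᵣ x} {x} λ n → ℚ.+-identityˡ (seq x n))
                       , (λ x → ≗⇒≈ᵣ {x +ᵣ fromℚ 0ℚ} {x} λ n → ℚ.+-identityʳ (seq x n))
            }
          ; inverse = (λ x → ≗⇒≈ᵣ { -ᵣ x +ᵣ x} {fromℚ 0ℚ} λ n → ℚ.+-inverseˡ (seq x n))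
                    , (λ x → ≗⇒≈ᵣ {x +ᵣ (-ᵣ x)} {fromℚ 0ℚ} λ n → ℚ.+-inverseʳ (seq x n))
          ; ⁻¹-cong = λ {x} {y} p → mk≈ᵣ (null-cong (λ n → solve 2 (λ a b → :- (a :- b) := (:- a) :- (:- b)) ≡.refl (seq x n) (seq y n)) (null-neg (null p)))
          }
        ; comm = λ x y → ≗⇒≈ᵣ {x +ᵣ y} {y +ᵣ x} λ n → ℚ.+-comm (seq x n) (seq y n)
        }
      ; *-cong = λ {x} {y} {u} {v} p q → mk≈ᵣ (null-cong
          (λ n → solve 4 (λ a b c d → c :* (a :- b) :+ b :* (c :- d) := a :* c :- b :* d) ≡.refl (seq x n) (seq y n) (seq u n) (seq v n))
          (null-+ {λ n → seq u n ℚ.* (seq x n ℚ.- seq y n)} {λ n → seq y n ℚ.* (seq u n ℚ.- seq v n)}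
            (null-* {b = seq u} (cauchy⇒bounded {seq u} (cauchy u)) (null p))
            (null-* {b = seq y} (cauchy⇒bounded {seq y} (cauchy y)) (null q))))
      ; *-assoc = λ x y z → ≗⇒≈ᵣ {(x *ᵣ y) *ᵣ z} {x *ᵣ (y *ᵣ z)} λ n → ℚ.*-assoc (seq x n) (seq y n) (seq z n)
      ; *-identity = (λ x → ≗⇒≈ᵣ {fromℚ 1ℚ *ᵣ x} {x} λ n → ℚ.*-identityˡ (seq x n))
                   , (λ x → ≗⇒≈ᵣ {x *ᵣ fromℚ 1ℚ} {x} λ n → ℚ.*-identityʳ (seq x n))
      ; distrib = (λ x y z → ≗⇒≈ᵣ {x *ᵣ (y +ᵣ z)} {x *ᵣ y +ᵣ x *ᵣ z} λ n → ℚ.*-distribˡ-+ (seq x n) (seq y n) (seq z n))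
                , (λ x y z → ≗⇒≈ᵣ {(y +ᵣ z) *ᵣ x} {y *ᵣ x +ᵣ z *ᵣ x} λ n → ℚ.*-distribʳ-+ (seq x n) (seq y n) (seq z n))
      }
    ; *-comm = λ x y → ≗⇒≈ᵣ {x *ᵣ y} {y *ᵣ x} λ n → ℚ.*-comm (seq x n) (seq y n)
    }
  }
  where open +-*-Solver

open RealLemmas
open ℝ

record ℂ : Set where
  constructor _+i_
  field
    re im : ℝ
open ℂ

infix 4 _≈ᶜ_
record _≈ᶜ_ (z w : ℂ) : Set where
  constructor mk≈ᶜ
  field
    re≈ : re z ≈ᵣ re w
    im≈ : im z ≈ᵣ im w
open _≈ᶜ_

infixl 6 _+ᶜ_ _-ᶜ_
infixl 7 _*ᶜ_
_+ᶜ_ _*ᶜ_ _-ᶜ_ : ℂ → ℂ → ℂ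
z +ᶜ w = (re z +ᵣ re w) +i (im z +ᵣ im w)
z *ᶜ w = (re z *ᵣ re w +ᵣ (-ᵣ (im z *ᵣ im w))) +i (re z *ᵣ im w +ᵣ im z *ᵣ re w)

negᶜ : ℂ → ℂ
negᶜ z = (-ᵣ re z) +i (-ᵣ im z)

z -ᶜ w = z +ᶜ negᶜ w

0ᶜ 1ᶜ : ℂ
0ᶜ = fromℚ 0ℚ +i fromℚ 0ℚ
1ᶜ = fromℚ 1ℚ +i fromℚ 0ℚ

normSq : ℂ → ℝ
normSq z = re z *ᵣ re z +ᵣ im z *ᵣ im z

ℂ-commutativeRing : CommutativeRing 0ℓ 0ℓ
ℂ-commutativeRing = record
  { Carrier = ℂ ; _≈_ = _≈ᶜ_ ; _+_ = _+ᶜ_ ; _*_ = _*ᶜ_ ; -_ = negᶜ ; 0# = 0ᶜ ; 1# = 1ᶜ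
  ; isCommutativeRing = record
    { isRing = record
      { +-isAbelianGroup = record
        { isGroup = record
          { isMonoid = record
            { isSemigroup = record
              { isMagma = record
                { isEquivalence = record
                  { refl  = mk≈ᶜ R.refl R.refl
                  ; sym   = λ p → mk≈ᶜ (R.sym (re≈ p)) (R.sym (im≈ p))
                  ; trans = λ p q → mk≈ᶜ (R.trans (re≈ p) (re≈ q)) (R.trans (im≈ p) (im≈ q))
                  }
                ; ∙-cong = λ p q → mk≈ᶜ (R.+-cong (re≈ p) (re≈ q)) (R.+-cong (im≈ p) (im≈ q))
                }
              ; assoc = λ x y z → mk≈ᶜ (R.+-assoc (re x) (re y) (re z)) (R.+-assoc (im x) (im y) (im z))
              }
            ; identity = (λ x → mk≈ᶜ (R.+-identityˡ (re x)) (R.+-identityˡ (im x)))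
                       , (λ x → mk≈ᶜ (R.+-identityʳ (re x)) (R.+-identityʳ (im x)))
            }
          ; inverse = (λ x → mk≈ᶜ (R.-‿inverseˡ (re x)) (R.-‿inverseˡ (im x)))
                    , (λ x → mk≈ᶜ (R.-‿inverseʳ (re x)) (R.-‿inverseʳ (im x)))
          ; ⁻¹-cong = λ p → mk≈ᶜ (R.-‿cong (re≈ p)) (R.-‿cong (im≈ p))
          }
        ; comm = λ x y → mk≈ᶜ (R.+-comm (re x) (re y)) (R.+-comm (im x) (im y))
        }
      ; *-cong = λ p q → mk≈ᶜ
          (R.+-cong (R.*-cong (re≈ p) (re≈ q)) (R.-‿cong (R.*-cong (im≈ p) (im≈ q))))
          (R.+-cong (R.*-cong (re≈ p) (im≈ q)) (R.*-cong (im≈ p) (re≈ q)))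
      ; *-assoc = *-assoc
      ; *-identity = *-identityˡ , (λ x → ≈-trans (*-comm x 1ᶜ) (*-identityˡ x))
      ; distrib = distribˡ , λ x y z → ≈-trans (*-comm (y +ᶜ z) x) (≈-trans (distribˡ x y z)
          (mk≈ᶜ (R.+-cong (re≈ (*-comm x y)) (re≈ (*-comm x z)))
                (R.+-cong (im≈ (*-comm x y)) (im≈ (*-comm x z)))))
      }
    ; *-comm = *-comm
    }
  }
  where
    open +-*-Solver
    module R = CommutativeRing ℝ-commutativeRing
    ≈-trans : ∀ {x y z} → x ≈ᶜ y → y ≈ᶜ z → x ≈ᶜ z
    ≈-trans p q = mk≈ᶜ (R.trans (re≈ p) (re≈ q)) (R.trans (im≈ p) (im≈ q))
    *-comm : ∀ x y → x *ᶜ y ≈ᶜ y *ᶜ x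
    *-comm x y = mk≈ᶜ
      (≗⇒≈ᵣ λ n → solve 4 (λ a b c d → a :* c :+ :- (b :* d) := c :* a :+ :- (d :* b)) ≡.refl
        (seq (re x) n) (seq (im x) n) (seq (re y) n) (seq (im y) n))
      (≗⇒≈ᵣ λ n → solve 4 (λ a b c d → a :* d :+ b :* c := c :* b :+ d :* a) ≡.refl
        (seq (re x) n) (seq (im x) n) (seq (re y) n) (seq (im y) n))
    *-identityˡ : ∀ x → 1ᶜ *ᶜ x ≈ᶜ x
    *-identityˡ x = mk≈ᶜ
      (≗⇒≈ᵣ λ n → solve 2 (λ a b → con 1ℚ :* a :+ :- (con 0ℚ :* b) := a) ≡.refl (seq (re x) n) (seq (im x) n))
      (≗⇒≈ᵣ λ n → solve 2 (λ a b → con 1ℚ :* b :+ con 0ℚ :* a := b) ≡.refl (seq (re x) n) (seq (im x) n))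
    *-assoc : ∀ x y z → (x *ᶜ y) *ᶜ z ≈ᶜ x *ᶜ (y *ᶜ z)
    *-assoc x y z = mk≈ᶜ
      (≗⇒≈ᵣ λ n → solve 6 (λ a b c d e f →
          (a :* c :+ :- (b :* d)) :* e :+ :- ((a :* d :+ b :* c) :* f)
            := a :* (c :* e :+ :- (d :* f)) :+ :- (b :* (c :* f :+ d :* e))) ≡.refl
        (seq (re x) n) (seq (im x) n) (seq (re y) n) (seq (im y) n) (seq (re z) n) (seq (im z) n))
      (≗⇒≈ᵣ λ n → solve 6 (λ a b c d e f →
          (a :* c :+ :- (b :* d)) :* f :+ (a :* d :+ b :* c) :* e
            := a :* (c :* f :+ d :* e) :+ b :* (c :* e :+ :- (d :* f))) ≡.refl
        (seq (re x) n) (seq (im x) n) (seq (re y) n) (seq (im y) n) (seq (re z) n) (seq (im z) n))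
    distribˡ : ∀ x y z → x *ᶜ (y +ᶜ z) ≈ᶜ x *ᶜ y +ᶜ x *ᶜ z
    distribˡ x y z = mk≈ᶜ
      (≗⇒≈ᵣ λ n → solve 6 (λ a b c d e f →
          a :* (c :+ e) :+ :- (b :* (d :+ f)) := (a :* c :+ :- (b :* d)) :+ (a :* e :+ :- (b :* f))) ≡.refl
        (seq (re x) n) (seq (im x) n) (seq (re y) n) (seq (im y) n) (seq (re z) n) (seq (im z) n))
      (≗⇒≈ᵣ λ n → solve 6 (λ a b c d e f →
          a :* (d :+ f) :+ b :* (c :+ e) := (a :* d :+ b :* c) :+ (a :* f :+ b :* e)) ≡.refl
        (seq (re x) n) (seq (im x) n) (seq (re y) n) (seq (im y) n) (seq (re z) n) (seq (im z) n))

module ℂ′ = CommutativeRing ℂ-commutativeRing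

record ℂ-Algebra : Set₁ where
  field
    commutativeRing : CommutativeRing 0ℓ 0ℓ
  open CommutativeRing commutativeRing public hiding (zero)
  field
    ι     : ℂ → Carrier
    ι-hom : RingMorphisms.IsRingHomomorphism ℂ′.rawRing rawRing ι
  open Sum semiring public
    using (sum; sum-cong-≋; ∑-comm; *-distribˡ-sum; *-distribʳ-sum)
  open CommutativeMonoidSum *-commutativeMonoid public using () renaming (sum to product)
  open Exp semiring public using (_^_)

eqIn : (A : ℂ-Algebra) → ℂ-Algebra.Carrier A → ℂ-Algebra.Carrier A → Set
eqIn A = ℂ-Algebra._≈_ A

infix 4 eqIn
syntax eqIn A x y = x ≈[ A ] y

ℂ-algebra : ℂ-Algebra
ℂ-algebra = record
  { commutativeRing = ℂ-commutativeRing ; ι = id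
  ; ι-hom = Identity.isRingHomomorphism ℂ′.rawRing ℂ′.refl }

record AlgHom (A B : ℂ-Algebra) : Set where
  private
    module A = ℂ-Algebra A
    module B = ℂ-Algebra B
  field
    ⟦_⟧       : A.Carrier → B.Carrier
    isRingHom : RingMorphisms.IsRingHomomorphism A.rawRing B.rawRing ⟦_⟧
    ι-comm    : ∀ z → ⟦ A.ι z ⟧ B.≈ B.ι z
  open RingMorphisms.IsRingHomomorphism isRingHom public
    using (⟦⟧-cong; +-homo; *-homo; 0#-homo; 1#-homo; -‿homo)
open AlgHom public using (⟦_⟧)

idHom : ∀ A → AlgHom A A
idHom A = record
  { ⟦_⟧ = id ; isRingHom = Identity.isRingHomomorphism A.rawRing A.refl ; ι-comm = λ _ → A.refl }
  where module A = ℂ-Algebra A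

infixr 9 _∘ʰ_
_∘ʰ_ : ∀ {A B C} → AlgHom B C → AlgHom A B → AlgHom A C
_∘ʰ_ {A} {B} {C} k h = record
  { ⟦_⟧ = ⟦ k ⟧ ∘ ⟦ h ⟧
  ; isRingHom = Composition.isRingHomomorphism C.trans (AlgHom.isRingHom h) (AlgHom.isRingHom k)
  ; ι-comm = λ z → C.trans (AlgHom.⟦⟧-cong k (AlgHom.ι-comm h z)) (AlgHom.ι-comm k z) }
  where module C = ℂ-Algebra C

module Matrices (A : ℂ-Algebra) where
  open ℂ-Algebra A

  Vec : ℕ → Set
  Vec n = Fin n → Carrier

  Matrix : ℕ → ℕ → Set
  Matrix m n = Fin m → Fin n → Carrier

  infix 4 _≈ᵛ_ _≈ᵐ_
  _≈ᵛ_ : ∀ {n} → Vec n → Vec n → Set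
  u ≈ᵛ v = ∀ i → u i ≈ v i

  _≈ᵐ_ : ∀ {m n} → Matrix m n → Matrix m n → Set
  M ≈ᵐ N = ∀ i j → M i j ≈ N i j

  δ : ∀ {n} → Fin n → Fin n → Carrier
  δ i j with i ≟ᶠ j
  ... | yes _ = 1#
  ... | no  _ = 0#

  infixl 7 _·_
  _·_ : ∀ {l m n} → Matrix l m → Matrix m n → Matrix l n
  (M · N) i k = sum (λ j → M i j * N j k)

  infixr 7 _·ᵥ_
  _·ᵥ_ : ∀ {m n} → Matrix m n → Vec n → Vec m
  (M ·ᵥ v) i = sum (λ j → M i j * v j)

  ·-cong : ∀ {l m n} {M M′ : Matrix l m} {N N′ : Matrix m n} → M ≈ᵐ M′ → N ≈ᵐ N′ → M · N ≈ᵐ M′ · N′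
  ·-cong p q i k = sum-cong-≋ (λ j → *-cong (p i j) (q j k))

  ·-assoc : ∀ {k l m n} (M : Matrix k l) (N : Matrix l m) (P : Matrix m n) →
            (M · N) · P ≈ᵐ M · (N · P)
  ·-assoc M N P i k = begin
    sum (λ j → sum (λ h → M i h * N h j) * P j k)
      ≈⟨ sum-cong-≋ (λ j → *-distribʳ-sum (P j k) (λ h → M i h * N h j)) ⟩
    sum (λ j → sum (λ h → M i h * N h j * P j k))
      ≈⟨ ∑-comm (λ j h → M i h * N h j * P j k) ⟩
    sum (λ h → sum (λ j → M i h * N h j * P j k))
      ≈⟨ sum-cong-≋ (λ h → sum-cong-≋ (λ j → *-assoc (M i h) (N h j) (P j k))) ⟩
    sum (λ h → sum (λ j → M i h * (N h j * P j k)))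
      ≈⟨ sum-cong-≋ (λ h → *-distribˡ-sum (M i h) (λ j → N h j * P j k)) ⟨
    sum (λ h → M i h * sum (λ j → N h j * P j k)) ∎
    where open SetoidReasoning setoid

  ≈ᵐ-trans : ∀ {m n} {M N P : Matrix m n} → M ≈ᵐ N → N ≈ᵐ P → M ≈ᵐ P
  ≈ᵐ-trans p q i j = trans (p i j) (q i j)

  ≈ᵐ-refl : ∀ {m n} {M : Matrix m n} → M ≈ᵐ M
  ≈ᵐ-refl i j = refl

  ≈ᵐ-sym : ∀ {m n} {M N : Matrix m n} → M ≈ᵐ N → N ≈ᵐ M
  ≈ᵐ-sym p i j = sym (p i j)

  δ-diag : ∀ {n} (i : Fin n) → δ i i ≈ 1#
  δ-diag i with i ≟ᶠ i
  ... | yes _ = refl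
  ... | no i≢i with () ← i≢i ≡.refl

  δ-suc : ∀ {n} (i j : Fin n) → δ (suc i) (suc j) ≈ δ i j
  δ-suc i j with i ≟ᶠ j
  ... | yes _ = refl
  ... | no  _ = refl

  sum-0 : ∀ {n} (f : Fin n → Carrier) → (∀ i → f i ≈ 0#) → sum f ≈ 0#
  sum-0 {zero}  f p = refl
  sum-0 {suc n} f p = trans (+-cong (p zero) (sum-0 (f ∘ suc) (p ∘ suc))) (+-identityˡ 0#)

  δ·ᵥ : ∀ {n} (v : Vec n) → δ ·ᵥ v ≈ᵛ v
  δ·ᵥ {suc n} v zero = trans (+-cong (*-identityˡ (v zero))
    (sum-0 (λ j → 0# * v (suc j)) (λ j → zeroˡ (v (suc j))))) (+-identityʳ (v zero))
  δ·ᵥ {suc n} v (suc i) = trans (+-cong (zeroˡ (v zero)) (trans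
    (sum-cong-≋ (λ j → *-congʳ (δ-suc i j))) (δ·ᵥ (v ∘ suc) i))) (+-identityˡ (v (suc i)))

  ·-identityˡ : ∀ {m n} (M : Matrix m n) → δ · M ≈ᵐ M
  ·-identityˡ M i k = δ·ᵥ (λ j → M j k) i

-- GL n A: an invertible matrix together with its inverse.
record GL (n : ℕ) (A : ℂ-Algebra) : Set where
  open Matrices A
  field
    mat inv : Matrix n n
    invʳ    : mat · inv ≈ᵐ δ
    invˡ    : inv · mat ≈ᵐ δ
open GL public

module _ {A : ℂ-Algebra} where
  open Matrices A

  infixl 7 _∙_
  _∙_ : ∀ {n} → GL n A → GL n A → GL n A
  γ ∙ η = record
    { mat = mat γ · mat η ; inv = inv η · inv γ
    ; invʳ = cancel (mat γ) (mat η) (inv η) (inv γ) (invʳ η) (invʳ γ)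
    ; invˡ = cancel (inv η) (inv γ) (mat γ) (mat η) (invˡ γ) (invˡ η) }
    where
      cancel : ∀ {n} (a b c d : Matrix n n) → b · c ≈ᵐ δ → a · d ≈ᵐ δ → (a · b) · (c · d) ≈ᵐ δ
      cancel a b c d bc ad = ≈ᵐ-trans (·-assoc a b (c · d)) (≈ᵐ-trans
        (·-cong {M = a} ≈ᵐ-refl (≈ᵐ-trans (≈ᵐ-sym (·-assoc b c d))
          (≈ᵐ-trans (·-cong {N = d} bc ≈ᵐ-refl) (·-identityˡ d)))) ad)

module _ {A B : ℂ-Algebra} (h : AlgHom A B) where
  private
    module A = ℂ-Algebra A
    module B = ℂ-Algebra B
    module MA = Matrices A
    module MB = Matrices B
    module h = AlgHom h

  sum-homo : ∀ {n} (f : Fin n → A.Carrier) → ⟦ h ⟧ (A.sum f) B.≈ B.sum (⟦ h ⟧ ∘ f)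
  sum-homo {zero}  f = h.0#-homo
  sum-homo {suc n} f = B.trans (h.+-homo _ _) (B.+-congˡ (sum-homo (f ∘ suc)))

  mapᵐ : ∀ {m n} → MA.Matrix m n → MB.Matrix m n
  mapᵐ M i j = ⟦ h ⟧ (M i j)

  mapᵐ-· : ∀ {l m n} (M : MA.Matrix l m) (N : MA.Matrix m n) → mapᵐ (M MA.· N) MB.≈ᵐ mapᵐ M MB.· mapᵐ N
  mapᵐ-· M N i k = B.trans (sum-homo (λ j → M i j A.* N j k)) (B.sum-cong-≋ (λ j → h.*-homo (M i j) (N j k)))

  mapᵐ-δ : ∀ {n} → mapᵐ {n} MA.δ MB.≈ᵐ MB.δ
  mapᵐ-δ i j with i ≟ᶠ j
  ... | yes _ = h.1#-homo
  ... | no  _ = h.0#-homo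

  mapGL : ∀ {n} → GL n A → GL n B
  mapGL γ = record
    { mat = mapᵐ (mat γ) ; inv = mapᵐ (inv γ)
    ; invʳ = go (mat γ) (inv γ) (invʳ γ) ; invˡ = go (inv γ) (mat γ) (invˡ γ) }
    where
      go : ∀ {n} (M N : MA.Matrix n n) → M MA.· N MA.≈ᵐ MA.δ → mapᵐ M MB.· mapᵐ N MB.≈ᵐ MB.δ
      go M N p = MB.≈ᵐ-trans (MB.≈ᵐ-sym (mapᵐ-· M N))
                   (MB.≈ᵐ-trans (λ i j → h.⟦⟧-cong (p i j)) mapᵐ-δ)

-- A rational representation of GL(g) on ℂ^dim: a homomorphism of algebraic
-- groups GL_g → GL_dim over ℂ, given through its functor of points.
record Rep (g : ℕ) : Set₁ where
  field
    dim     : ℕ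
    act     : ∀ {A} → GL g A → GL dim A
    cong    : ∀ {A} {γ η : GL g A} → let open Matrices A in
              mat γ ≈ᵐ mat η → mat (act γ) ≈ᵐ mat (act η)
    homo    : ∀ {A} (γ η : GL g A) → let open Matrices A in
              mat (act (γ ∙ η)) ≈ᵐ mat (act γ) · mat (act η)
    natural : ∀ {A B} (h : AlgHom A B) (γ : GL g A) → let open Matrices B in
              mat (act (mapGL h γ)) ≈ᵐ mapᵐ h (mat (act γ))
open Rep public using (dim; act)

FreeModule : (A : ℂ-Algebra) → ℕ → Module (ℂ-Algebra.commutativeRing A) 0ℓ 0ℓ
FreeModule A n = record
  { Carrierᴹ = Vec n ; _≈ᴹ_ = _≈ᵛ_
  ; _+ᴹ_ = λ u v i → u i + v i ; _*ₗ_ = λ a v i → a * v i ; _*ᵣ_ = λ v a i → a * v i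
  ; 0ᴹ = λ _ → 0# ; -ᴹ_ = λ v i → - v i
  ; isModule = IsModuleFromLeft.isModule record
    { isLeftModule = record
      { isLeftSemimodule = record
        { +ᴹ-isCommutativeMonoid = record
          { isMonoid = record
            { isSemigroup = record
              { isMagma = record
                { isEquivalence = record
                  { refl = λ _ → refl ; sym = λ p i → sym (p i) ; trans = λ p q i → trans (p i) (q i) }
                ; ∙-cong = λ p q i → +-cong (p i) (q i) }
              ; assoc = λ u v w i → +-assoc (u i) (v i) (w i) }
            ; identity = (λ v i → +-identityˡ (v i)) , (λ v i → +-identityʳ (v i)) }
          ; comm = λ u v i → +-comm (u i) (v i) }
        ; isPreleftSemimodule = record
          { *ₗ-cong = λ p q i → *-cong p (q i)
          ; *ₗ-zeroˡ = λ v i → zeroˡ (v i)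
          ; *ₗ-distribʳ = λ v a b i → distribʳ (v i) a b
          ; *ₗ-identityˡ = λ v i → *-identityˡ (v i)
          ; *ₗ-assoc = λ a b v i → *-assoc a b (v i)
          ; *ₗ-zeroʳ = λ a i → zeroʳ a
          ; *ₗ-distribˡ = λ a u v i → distribˡ a (u i) (v i) } }
      ; -ᴹ‿cong = λ p i → -‿cong (p i)
      ; -ᴹ‿inverse = (λ v i → -‿inverseˡ (v i)) , (λ v i → -‿inverseʳ (v i)) } } }
  where
    open ℂ-Algebra A
    open Matrices A

-- Sym^d(M) is the quotient of the formal sums of terms r · v₀v₁…v_{d-1} by the
-- congruence making this expression multilinear and symmetric.
module SymmetricPower {R : CommutativeRing 0ℓ 0ℓ} (M : Module R 0ℓ 0ℓ) (d : ℕ) where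
  open CommutativeRing R
  open Module M using (Carrierᴹ; _≈ᴹ_; _+ᴹ_; _*ₗ_; ≈ᴹ-refl; ≈ᴹ-setoid)

  Term : Set
  Term = Carrier × (Fin d → Carrierᴹ)

  FormalSum : Set
  FormalSum = List Term

  infix 4 _≈ˢ_
  data _≈ˢ_ : FormalSum → FormalSum → Set where
    ≈ˢ-refl   : ∀ {x} → x ≈ˢ x
    ≈ˢ-sym    : ∀ {x y} → x ≈ˢ y → y ≈ˢ x
    ≈ˢ-trans  : ∀ {x y z} → x ≈ˢ y → y ≈ˢ z → x ≈ˢ z
    ++-cong   : ∀ {x y z w} → x ≈ˢ y → z ≈ˢ w → x ++ z ≈ˢ y ++ w
    ++-comm   : ∀ x y → x ++ y ≈ˢ y ++ x
    term-cong : ∀ {r s v w} → r ≈ s → (∀ k → v k ≈ᴹ w k) → (r , v) ∷ [] ≈ˢ (s , w) ∷ []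
    coeff-+   : ∀ r s v → (r + s , v) ∷ [] ≈ˢ (r , v) ∷ (s , v) ∷ []
    coeff-0   : ∀ v → (0# , v) ∷ [] ≈ˢ []
    slot-+    : ∀ r k {u v w} → w k ≈ᴹ u k +ᴹ v k →
                (∀ l → l ≢ k → w l ≈ᴹ u l) → (∀ l → l ≢ k → w l ≈ᴹ v l) →
                (r , w) ∷ [] ≈ˢ (r , u) ∷ (r , v) ∷ []
    slot-*    : ∀ r k a {v w} → w k ≈ᴹ a *ₗ v k → (∀ l → l ≢ k → w l ≈ᴹ v l) →
                (r , w) ∷ [] ≈ˢ (r * a , v) ∷ []
    permute   : ∀ r (π : Permutation′ d) v → (r , v ∘ (π ⟨$⟩ʳ_)) ∷ [] ≈ˢ (r , v) ∷ []

  scale : Carrier → FormalSum → FormalSum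
  scale a = List.map (map₁ (a *_))

  private
    ≡⇒≈ˢ : ∀ {x y} → x ≡ y → x ≈ˢ y
    ≡⇒≈ˢ ≡.refl = ≈ˢ-refl

    scale-terms : (a b : Carrier) → a ≈ b → ∀ x → scale a x ≈ˢ scale b x
    scale-terms a b p []            = ≈ˢ-refl
    scale-terms a b p ((r , v) ∷ x) = ++-cong (term-cong (*-congʳ p) (λ _ → ≈ᴹ-refl)) (scale-terms a b p x)

    scale-≈ : ∀ a {x y} → x ≈ˢ y → scale a x ≈ˢ scale a y
    scale-≈ a ≈ˢ-refl        = ≈ˢ-refl
    scale-≈ a (≈ˢ-sym p)     = ≈ˢ-sym (scale-≈ a p)
    scale-≈ a (≈ˢ-trans p q) = ≈ˢ-trans (scale-≈ a p) (scale-≈ a q)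
    scale-≈ a (++-cong {x} {y} {z} {w} p q) =
      ≈ˢ-trans (≡⇒≈ˢ (List.map-++ _ x z)) (≈ˢ-trans (++-cong (scale-≈ a p) (scale-≈ a q))
        (≡⇒≈ˢ (≡.sym (List.map-++ _ y w))))
    scale-≈ a (++-comm x y) =
      ≈ˢ-trans (≡⇒≈ˢ (List.map-++ _ x y)) (≈ˢ-trans (++-comm (scale a x) (scale a y))
        (≡⇒≈ˢ (≡.sym (List.map-++ _ y x))))
    scale-≈ a (term-cong p q)  = term-cong (*-congˡ p) q
    scale-≈ a (coeff-+ r s v)  = ≈ˢ-trans (term-cong (distribˡ a r s) (λ _ → ≈ᴹ-refl)) (coeff-+ (a * r) (a * s) v)
    scale-≈ a (coeff-0 v)      = ≈ˢ-trans (term-cong (zeroʳ a) (λ _ → ≈ᴹ-refl)) (coeff-0 v)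
    scale-≈ a (slot-+ r k p q q′) = slot-+ (a * r) k p q q′
    scale-≈ a (slot-* r k b p q)  = ≈ˢ-trans (slot-* (a * r) k b p q) (term-cong (*-assoc a r b) (λ _ → ≈ᴹ-refl))
    scale-≈ a (permute r π v)     = permute (a * r) π v

    scale-0 : ∀ x → scale 0# x ≈ˢ []
    scale-0 []            = ≈ˢ-refl
    scale-0 ((r , v) ∷ x) =
      ++-cong (≈ˢ-trans (term-cong (zeroˡ r) (λ _ → ≈ᴹ-refl)) (coeff-0 v)) (scale-0 x)

    scale-1 : ∀ x → scale 1# x ≈ˢ x
    scale-1 []            = ≈ˢ-refl
    scale-1 ((r , v) ∷ x) = ++-cong (term-cong (*-identityˡ r) (λ _ → ≈ᴹ-refl)) (scale-1 x)

    scale-assoc : ∀ a b x → scale (a * b) x ≈ˢ scale a (scale b x)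
    scale-assoc a b []            = ≈ˢ-refl
    scale-assoc a b ((r , v) ∷ x) = ++-cong (term-cong (*-assoc a b r) (λ _ → ≈ᴹ-refl)) (scale-assoc a b x)

    scale-+ : ∀ x a b → scale (a + b) x ≈ˢ scale a x ++ scale b x
    scale-+ []            a b = ≈ˢ-refl
    scale-+ ((r , v) ∷ x) a b = ≈ˢ-trans
      (++-cong {x = (_ , v) ∷ []} (≈ˢ-trans (term-cong (distribʳ r a b) (λ _ → ≈ᴹ-refl)) (coeff-+ (a * r) (b * r) v)) (scale-+ x a b))
      (++-cong {x = (a * r , v) ∷ []} ≈ˢ-refl
        (≈ˢ-trans (≡⇒≈ˢ (≡.sym (List.++-assoc ((b * r , v) ∷ []) (scale a x) (scale b x))))
          (≈ˢ-trans (++-cong (++-comm ((b * r , v) ∷ []) (scale a x)) ≈ˢ-refl)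
            (≡⇒≈ˢ (List.++-assoc (scale a x) ((b * r , v) ∷ []) (scale b x))))))

    scale-inverseˡ : ∀ x → scale (- 1#) x ++ x ≈ˢ []
    scale-inverseˡ x = ≈ˢ-trans (++-cong ≈ˢ-refl (≈ˢ-sym (scale-1 x)))
      (≈ˢ-trans (≈ˢ-sym (scale-+ x (- 1#) 1#)) (≈ˢ-trans (scale-terms _ _ (-‿inverseˡ 1#) x) (scale-0 x)))

  Sym : Module R 0ℓ 0ℓ
  Sym = record
    { Carrierᴹ = FormalSum ; _≈ᴹ_ = _≈ˢ_ ; _+ᴹ_ = _++_ ; 0ᴹ = []
    ; _*ₗ_ = scale ; _*ᵣ_ = λ x a → scale a x ; -ᴹ_ = scale (- 1#)
    ; isModule = IsModuleFromLeft.isModule record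
      { isLeftModule = record
        { isLeftSemimodule = record
          { +ᴹ-isCommutativeMonoid = record
            { isMonoid = record
              { isSemigroup = record
                { isMagma = record
                  { isEquivalence = record { refl = ≈ˢ-refl ; sym = ≈ˢ-sym ; trans = ≈ˢ-trans }
                  ; ∙-cong = ++-cong }
                ; assoc = λ x y z → ≡⇒≈ˢ (List.++-assoc x y z) }
              ; identity = (λ _ → ≈ˢ-refl) , (λ x → ≡⇒≈ˢ (List.++-identityʳ x)) }
            ; comm = ++-comm }
          ; isPreleftSemimodule = record
            { *ₗ-cong = λ {a} {b} {x} {y} p q → ≈ˢ-trans (scale-terms a b p x) (scale-≈ b q)
            ; *ₗ-zeroˡ = scale-0
            ; *ₗ-distribʳ = scale-+
            ; *ₗ-identityˡ = scale-1
            ; *ₗ-assoc = scale-assoc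
            ; *ₗ-zeroʳ = λ _ → ≈ˢ-refl
            ; *ₗ-distribˡ = λ a x y → ≡⇒≈ˢ (List.map-++ _ x y) } }
        ; -ᴹ‿cong = scale-≈ (- 1#)
        ; -ᴹ‿inverse = scale-inverseˡ , (λ x → ≈ˢ-trans (++-comm x (scale (- 1#) x)) (scale-inverseˡ x)) } } }

  power : Carrierᴹ → FormalSum
  power v = (1# , λ _ → v) ∷ []

SymFree : (A : ℂ-Algebra) (d n : ℕ) → Module (ℂ-Algebra.commutativeRing A) 0ℓ 0ℓ
SymFree A d n = SymmetricPower.Sym (FreeModule A n) d

module _ (A : ℂ-Algebra) (d : ℕ) where
  open ℂ-Algebra A
  open Matrices A
  private
    module S {n} = SymmetricPower (FreeModule A n) d
    module Sℂ {n} = SymmetricPower (FreeModule ℂ-algebra n) d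

  symMap : ∀ {m n} → Matrix m n → S.FormalSum {n} → S.FormalSum {m}
  symMap M = List.map (map₂ (λ v k → M ·ᵥ v k))

  -- The canonical map Sym^d(ℂ^n) → Sym^d(A^n).
  symι : ∀ {n} → Sℂ.FormalSum {n} → S.FormalSum {n}
  symι = List.map (λ t → ι (proj₁ t) , λ k i → ι (proj₂ t k i))

  -- ∑ f(j₁,…,j_d) over all d-tuples of elements of Fin n.
  ∑tuples : ∀ e {n} → ((Fin e → Fin n) → Carrier) → Carrier
  ∑tuples zero    f = f (λ ())
  ∑tuples (suc e) f = sum (λ j → ∑tuples e (λ J → f (j Vector.∷ J)))

  -- A-linear extension of a ℂ-linear φ : ℂ^m → Sym^d(ℂ^n).
  extendIntoSym : ∀ {m n} → ((Fin m → ℂ) → Sℂ.FormalSum {n}) → Vec m → S.FormalSum {n}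
  extendIntoSym {m} {n} φ w =
    CommutativeMonoidSum.sum (Module.+ᴹ-commutativeMonoid (SymFree A d n))
      (λ j → S.scale (w j) (symι (φ (Matrices.δ ℂ-algebra j))))

  -- A-linear extension Sym^d(A^n) → A^m of a ℂ-linear p : Sym^d(ℂ^n) → ℂ^m:
  -- expand v₁⋯v_d = ∑_J (∏_k v_k(J k)) e_{J 1}⋯e_{J d} and apply p to the e_J.
  -- It respects ≈ˢ whenever p does.
  extendFromSym : ∀ {m n} → (Sℂ.FormalSum {n} → Fin m → ℂ) → S.FormalSum {n} → Vec m
  extendFromSym p []            i = 0#
  extendFromSym p ((r , v) ∷ x) i =
    ∑tuples d (λ J → r * product (λ k → v k (J k)) * ι (p ((1ᶜ , Matrices.δ ℂ-algebra ∘ J) ∷ []) i))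
    + extendFromSym p x i

module ℝ′ = CommutativeRing ℝ-commutativeRing
open import Algebra.Module.Morphism.Structures using (module ModuleMorphisms)

Weight : ℕ → Set
Weight g = Fin g → ℤ

module _ {g : ℕ} (V : Rep g) where
  open ℂ-Algebra ℂ-algebra
  open Matrices ℂ-algebra

  infix 5 _#0
  _#0 : Vec (dim V) → Set
  v #0 = ∃[ i ] fromℚ 0ℚ <ᵣ normSq (v i)

  record IsInvariantSubspace (P : Vec (dim V) → Set) : Set where
    field
      resp      : ∀ {v w} → v ≈ᵛ w → P v → P w
      zero∈     : P (λ _ → 0#)
      +-closed  : ∀ {v w} → P v → P w → P (λ i → v i + w i)
      *-closed  : ∀ a {v} → P v → P (λ i → a * v i)
      invariant : ∀ (γ : GL g ℂ-algebra) {v} → P v → P (mat (act V γ) ·ᵥ v)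

  -- V ≠ 0, and the only invariant subspaces are 0 and V, in the form: an
  -- invariant subspace containing a nonzero vector is everything.
  record IsIrreducible : Set₁ where
    field
      nonzero    : ∃[ v ] v #0
      noSubspace : ∀ {P} → IsInvariantSubspace P → ∃[ v ] (P v × v #0) → ∀ w → P w

  diagPow : GL g ℂ-algebra → Fin g → ℤ → ℂ
  diagPow t i (+ n)    = mat t i i ^ n
  diagPow t i -[1+ n ] = inv t i i ^ suc n

  Diagonal : GL g ℂ-algebra → Set
  Diagonal t = ∀ i j → i ≢ j → mat t i j ≈ 0#

  UpperUnitriangular : GL g ℂ-algebra → Set
  UpperUnitriangular u = (∀ i → mat u i i ≈ 1#) × (∀ i j → j <ᶠ i → mat u i j ≈ 0#)

  -- Some nonzero vector is fixed by the upper unitriangular matrices, and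
  -- diag(t₁,…,t_g) acts on it by t₁^λ₁ ⋯ t_g^λ_g.
  HasHighestWeight : Weight g → Set
  HasHighestWeight λ′ = ∃[ v ] (v #0
    × (∀ u → UpperUnitriangular u → mat (act V u) ·ᵥ v ≈ᵛ v)
    × (∀ t → Diagonal t → mat (act V t) ·ᵥ v ≈ᵛ λ k → product (λ i → diagPow t i (λ′ i)) * v k))

module _ {g : ℕ} (d : ℕ) (V W : Rep g) where
  private
    module Symℂ = Module (SymFree ℂ-algebra d (dim V))
    module Wℂ = Module (FreeModule ℂ-algebra (dim W))

  -- A GL(g)-equivariant embedding φ : W ↪ Sym^d(V), equivariant as a morphism
  -- of representations of the algebraic group, i.e. on points in every ℂ-algebra.
  record Concomitant : Set₁ where
    field
      φ           : Wℂ.Carrierᴹ → Symℂ.Carrierᴹ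
      isMono      : ModuleMorphisms.IsModuleMonomorphism Wℂ.rawModule Symℂ.rawModule φ
      equivariant : ∀ A (γ : GL g A) (w : Matrices.Vec A (dim W)) →
        let open Matrices A
            open Module (SymFree A d (dim V)) using (_≈ᴹ_) in
        extendIntoSym A d φ (mat (act W γ) ·ᵥ w)
          ≈ᴹ symMap A d (mat (act V γ)) (extendIntoSym A d φ w)

  record Projection (I : Concomitant) : Set₁ where
    open Concomitant I using (φ)
    field
      p           : Symℂ.Carrierᴹ → Wℂ.Carrierᴹ
      isHom       : ModuleMorphisms.IsModuleHomomorphism Symℂ.rawModule Wℂ.rawModule p
      equivariant : ∀ A (γ : GL g A) (x : Module.Carrierᴹ (SymFree A d (dim V))) →
        let open Matrices A in
        extendFromSym A d p (symMap A d (mat (act V γ)) x)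
          ≈ᵛ mat (act W γ) ·ᵥ extendFromSym A d p x
      retraction  : ∀ w → p (φ w) Wℂ.≈ᴹ w

module ComplexAnalysis where
  open ℂ-Algebra ℂ-algebra using (_≈_; sum)
  open Matrices ℂ-algebra using (Vec; _≈ᵛ_)

  ‖_‖² : ∀ {n} → Vec n → ℝ
  ‖_‖² = CommutativeMonoidSum.sum ℝ′.+-commutativeMonoid ∘ (normSq ∘_)

  infixl 6 _-ᵛ_
  _-ᵛ_ : ∀ {n} → Vec n → Vec n → Vec n
  (w -ᵛ z) i = w i -ᶜ z i

  record Openℂ (n : ℕ) : Set₁ where
    infix 4 _∋_
    field
      _∋_    : Vec n → Set
      isOpen : ∀ {z} → _∋_ z → ∃[ ε ] (0ℚ ℚ.< ε
               × ∀ w → ‖ w -ᵛ z ‖² <ᵣ fromℚ (ε ℚ.* ε) → _∋_ w)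
  open Openℂ public using (_∋_)

  infix 4 _⊆ℂ_
  _⊆ℂ_ : ∀ {n} → Openℂ n → Openℂ n → Set
  U ⊆ℂ V = ∀ {z} → U ∋ z → V ∋ z

  record Holomorphic {n} (U : Openℂ n) : Set where
    field
      fun  : ∀ z → U ∋ z → ℂ
      cong : ∀ {z w} p q → z ≈ᵛ w → fun z p ≈ fun w q
      -- complex differentiability at z, all norms being squared
      diff : ∀ z p → Σ[ a ∈ Vec n ] ∀ ε → 0ℚ ℚ.< ε → ∃[ η ] (0ℚ ℚ.< η
             × ∀ w q → ‖ w -ᵛ z ‖² <ᵣ fromℚ (η ℚ.* η) →
               normSq (fun w q -ᶜ fun z p -ᶜ sum (λ i → a i *ᶜ (w i -ᶜ z i)))
                 ≤ᵣ fromℚ (ε ℚ.* ε) *ᵣ ‖ w -ᵛ z ‖²)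
  open Holomorphic public using (fun)

record Topology : Set₁ where
  field
    points : Setoid 0ℓ 0ℓ
  open Setoid points public
    using () renaming (Carrier to Point; _≈_ to _≈ₚ_; refl to ≈ₚ-refl; sym to ≈ₚ-sym; trans to ≈ₚ-trans)
  field
    IsOpen    : (Point → Set) → Set
    open-resp : ∀ {U} → IsOpen U → ∀ {x y} → x ≈ₚ y → U x → U y
    open-ext  : ∀ {U V} → (∀ x → U x → V x) → (∀ x → V x → U x) → IsOpen U → IsOpen V
    open-⊤    : IsOpen (λ _ → ⊤)
    open-∩    : ∀ {U V} → IsOpen U → IsOpen V → IsOpen (λ x → U x × V x)
    open-⋃    : ∀ {I : Set} {U : I → Point → Set} → (∀ i → IsOpen (U i)) → IsOpen (λ x → ∃[ i ] U i x)

  record Open : Set₁ where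
    constructor mkOpen
    infix 4 _∋_
    field
      _∋_    : Point → Set
      isOpen : IsOpen _∋_
  open Open public

  infix 4 _⊆_
  _⊆_ : Open → Open → Set
  U ⊆ V = ∀ {x} → U ∋ x → V ∋ x

  infixr 7 _∩_
  _∩_ : Open → Open → Open
  U ∩ V = mkOpen (λ x → U ∋ x × V ∋ x) (open-∩ (isOpen U) (isOpen V))

  whole : Open
  whole = mkOpen (λ _ → ⊤) open-⊤

record RingedSpace : Set₁ where
  field
    topology : Topology
  open Topology topology public
  field
    𝒪        : Open → ℂ-Algebra
    res      : ∀ U V → U ⊆ V → AlgHom (𝒪 V) (𝒪 U)
    res-id   : ∀ U (i : U ⊆ U) s → ⟦ res U U i ⟧ s ≈[ 𝒪 U ] s
    res-∘    : ∀ U V W (i : U ⊆ V) (j : V ⊆ W) (k : U ⊆ W) s →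
               ⟦ res U V i ⟧ (⟦ res V W j ⟧ s) ≈[ 𝒪 U ] ⟦ res U W k ⟧ s
    locality : ∀ {I : Set} (U : Open) (V : I → Open) (i : ∀ a → V a ⊆ U) →
               (∀ {x} → U ∋ x → ∃[ a ] V a ∋ x) → ∀ s t →
               (∀ a → ⟦ res (V a) U (i a) ⟧ s ≈[ 𝒪 (V a) ] ⟦ res (V a) U (i a) ⟧ t) →
               s ≈[ 𝒪 U ] t
    gluing   : ∀ {I : Set} (U : Open) (V : I → Open) (i : ∀ a → V a ⊆ U) →
               (∀ {x} → U ∋ x → ∃[ a ] V a ∋ x) →
               (s : ∀ a → ℂ-Algebra.Carrier (𝒪 (V a))) →
               (∀ a b → ⟦ res (V a ∩ V b) (V a) proj₁ ⟧ (s a)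
                          ≈[ 𝒪 (V a ∩ V b) ] ⟦ res (V a ∩ V b) (V b) proj₂ ⟧ (s b)) →
               ∃[ t ] ∀ a → ⟦ res (V a) U (i a) ⟧ t ≈[ 𝒪 (V a) ] s a

  Functions : Open → Set
  Functions U = ℂ-Algebra.Carrier (𝒪 U)

module _ where
  open ComplexAnalysis
  open ℂ-Algebra ℂ-algebra using (_≈_; sum)
  open Matrices ℂ-algebra using (Vec; _≈ᵛ_)

  -- An isomorphism of an open neighbourhood of x with the local model
  -- (Z , 𝒪_U / (f₁,…,f_k)), where Z = {f₁ = … = f_k = 0} ⊆ U ⊆ ℂ^n: a
  -- homeomorphism χ : dom → Z together with a map of sheaves of ℂ-algebras
  -- χ♯ : 𝒪_U → χ_* 𝒪_dom that is locally surjective with kernel (f₁,…,f_k).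
  record Chart (X : RingedSpace) (x : RingedSpace.Point X) : Set₁ where
    open RingedSpace X using (Point; _≈ₚ_; IsOpen; Open; mkOpen; _⊆_; 𝒪; res; Functions)
    open RingedSpace X using () renaming (_∋_ to _∋ₓ_)
    field
      dom   : Open
      x∈dom : dom ∋ₓ x
      n k   : ℕ
      U     : Openℂ n
      f     : Fin k → Holomorphic U

      χ          : ∀ y → dom ∋ₓ y → Vec n
      χ-cong     : ∀ {y z} p q → y ≈ₚ z → χ y p ≈ᵛ χ z q
      χ-inj      : ∀ {y z} p q → χ y p ≈ᵛ χ z q → y ≈ₚ z
      χ∈U        : ∀ y p → U ∋ χ y p
      χ-zero     : ∀ y p l → fun (f l) (χ y p) (χ∈U y p) ≈ 0ᶜ
      χ-surj     : ∀ z (q : U ∋ z) → (∀ l → fun (f l) z q ≈ 0ᶜ) → ∃[ y ] ∃[ p ] χ y p ≈ᵛ z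
      continuous : (V : Openℂ n) → IsOpen (λ y → Σ[ p ∈ dom ∋ₓ y ] V ∋ χ y p)
      χ-open     : ∀ N → N ⊆ dom → ∀ y p → N ∋ₓ y → ∃[ ε ] (0ℚ ℚ.< ε
                   × ∀ z q → ‖ χ z q -ᵛ χ y p ‖² <ᵣ fromℚ (ε ℚ.* ε) → N ∋ₓ z)

    χ⁻¹ : Openℂ n → Open
    χ⁻¹ V = mkOpen (λ y → Σ[ p ∈ dom ∋ₓ y ] V ∋ χ y p) (continuous V)

    field
      χ♯        : ∀ V → V ⊆ℂ U → Holomorphic V → Functions (χ⁻¹ V)
      -- The algebra operations of holomorphic functions are pointwise.
      χ♯-const  : ∀ V (i : V ⊆ℂ U) c h → (∀ z p → fun h z p ≈ c) →
                  χ♯ V i h ≈[ 𝒪 (χ⁻¹ V) ] ℂ-Algebra.ι (𝒪 (χ⁻¹ V)) c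
      χ♯-+      : ∀ V (i : V ⊆ℂ U) h₁ h₂ h → (∀ z p → fun h z p ≈ fun h₁ z p +ᶜ fun h₂ z p) →
                  χ♯ V i h ≈[ 𝒪 (χ⁻¹ V) ] ℂ-Algebra._+_ (𝒪 (χ⁻¹ V)) (χ♯ V i h₁) (χ♯ V i h₂)
      χ♯-*      : ∀ V (i : V ⊆ℂ U) h₁ h₂ h → (∀ z p → fun h z p ≈ fun h₁ z p *ᶜ fun h₂ z p) →
                  χ♯ V i h ≈[ 𝒪 (χ⁻¹ V) ] ℂ-Algebra._*_ (𝒪 (χ⁻¹ V)) (χ♯ V i h₁) (χ♯ V i h₂)
      χ♯-res    : ∀ V V′ (i : V ⊆ℂ U) (i′ : V′ ⊆ℂ U) (j : V′ ⊆ℂ V) h h′ →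
                  (∀ z p → fun h′ z p ≈ fun h z (j p)) →
                  χ♯ V′ i′ h′ ≈[ 𝒪 (χ⁻¹ V′) ] ⟦ res (χ⁻¹ V′) (χ⁻¹ V) (map₂ j) ⟧ (χ♯ V i h)
      f∈kernel  : ∀ (i : U ⊆ℂ U) l → χ♯ U i (f l) ≈[ 𝒪 (χ⁻¹ U) ] ℂ-Algebra.0# (𝒪 (χ⁻¹ U))
      kernel⊆⟨f⟩ : ∀ V (i : V ⊆ℂ U) h → χ♯ V i h ≈[ 𝒪 (χ⁻¹ V) ] ℂ-Algebra.0# (𝒪 (χ⁻¹ V)) →
                  ∀ y p → V ∋ χ y p →
                  Σ[ V′ ∈ Openℂ n ] Σ[ j ∈ V′ ⊆ℂ V ] (V′ ∋ χ y p
                    × Σ[ a ∈ (Fin k → Holomorphic V′) ]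
                      ∀ z q → fun h z (j q) ≈ sum (λ l → fun (a l) z q *ᶜ fun (f l) z (i (j q))))
      χ♯-surj   : ∀ N (s : Functions N) y p → N ∋ₓ y →
                  Σ[ V ∈ Openℂ n ] Σ[ i ∈ V ⊆ℂ U ] (V ∋ χ y p
                    × Σ[ j ∈ χ⁻¹ V ⊆ N ] Σ[ h ∈ Holomorphic V ]
                      χ♯ V i h ≈[ 𝒪 (χ⁻¹ V) ] ⟦ res (χ⁻¹ V) N j ⟧ s)

-- No separation or countability axiom is imposed.
record ComplexSpace : Set₁ where
  field
    ringedSpace : RingedSpace
    chart       : ∀ x → Chart ringedSpace x
  open RingedSpace ringedSpace public

-- Morphisms of ringed spaces over ℂ; between complex analytic spaces these are
-- automatically local on stalks.
infix 1 _⟶_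
record _⟶_ (X Y : ComplexSpace) : Set₁ where
  private
    module X = ComplexSpace X
    module Y = ComplexSpace Y
  field
    fun        : X.Point → Y.Point
    cong       : ∀ {x y} → x X.≈ₚ y → fun x Y.≈ₚ fun y
    continuous : ∀ {V} → Y.IsOpen V → X.IsOpen (V ∘ fun)

  preimage : Y.Open → X.Open
  preimage V = X.mkOpen (λ x → V Y.∋ fun x) (continuous (Y.isOpen V))

  field
    ♯     : ∀ V → AlgHom (Y.𝒪 V) (X.𝒪 (preimage V))
    ♯-res : ∀ V′ V (i : V′ Y.⊆ V) s →
            ⟦ X.res (preimage V′) (preimage V) i ⟧ (⟦ ♯ V ⟧ s)
              ≈[ X.𝒪 (preimage V′) ] ⟦ ♯ V′ ⟧ (⟦ Y.res V′ V i ⟧ s)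

  pull : ∀ V N → N X.⊆ preimage V → AlgHom (Y.𝒪 V) (X.𝒪 N)
  pull V N i = X.res N (preimage V) i ∘ʰ ♯ V
open _⟶_ public using (preimage; pull) renaming (fun to _$_)

infix 0 _≃_
record _≃_ {X Y : ComplexSpace} (F G : X ⟶ Y) : Set₁ where
  private
    module X = ComplexSpace X
    module Y = ComplexSpace Y
  field
    points    : ∀ x → (F $ x) Y.≈ₚ (G $ x)
    functions : ∀ V N (i : N X.⊆ preimage F V) (j : N X.⊆ preimage G V) s →
                ⟦ pull F V N i ⟧ s ≈[ X.𝒪 N ] ⟦ pull G V N j ⟧ s

idₘ : ∀ {X} → X ⟶ X
idₘ {X} = record
  { fun = id ; cong = id ; continuous = id ; ♯ = λ V → idHom (𝒪 V)
  ; ♯-res = λ V′ V i s → ℂ-Algebra.refl (𝒪 V′) }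
  where open ComplexSpace X

infixr 9 _∘ₘ_
_∘ₘ_ : ∀ {X Y Z} → Y ⟶ Z → X ⟶ Y → X ⟶ Z
_∘ₘ_ {X} {Y} {Z} G F = record
  { fun = G.fun ∘ F.fun ; cong = G.cong ∘ F.cong
  ; continuous = λ o → F.continuous (G.continuous o)
  ; ♯ = λ V → F.♯ (G.preimage V) ∘ʰ G.♯ V
  ; ♯-res = λ V′ V i s → ℂ-Algebra.trans (ComplexSpace.𝒪 X (F.preimage (G.preimage V′)))
      (F.♯-res (G.preimage V′) (G.preimage V) i (⟦ G.♯ V ⟧ s))
      (AlgHom.⟦⟧-cong (F.♯ (G.preimage V′)) (G.♯-res V′ V i s)) }
  where
    module F = _⟶_ F
    module G = _⟶_ G

record IsOpenImmersion {X Y : ComplexSpace} (F : X ⟶ Y) : Set₁ where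
  private
    module X = ComplexSpace X
    module Y = ComplexSpace Y
  field
    injective  : ∀ {x y} → (F $ x) Y.≈ₚ (F $ y) → x X.≈ₚ y
    image-open : ∀ N → Y.IsOpen (λ y → ∃[ x ] (N X.∋ x × (F $ x) Y.≈ₚ y))

  image : X.Open → Y.Open
  image N = Y.mkOpen _ (image-open N)

  ⊆image : ∀ N → N X.⊆ preimage F (image N)
  ⊆image N p = _ , p , Y.≈ₚ-refl

  field
    ♯-injective  : ∀ N s t → ⟦ pull F (image N) N (⊆image N) ⟧ s ≈[ X.𝒪 N ] ⟦ pull F (image N) N (⊆image N) ⟧ t →
                   s ≈[ Y.𝒪 (image N) ] t
    ♯-surjective : ∀ N t → ∃[ s ] ⟦ pull F (image N) N (⊆image N) ⟧ s ≈[ X.𝒪 N ] t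

-- The universal property of the product Y × ℂ^k, morphisms to ℂ^k being
-- k-tuples of global functions.
record IsProductWithℂ^ (k : ℕ) {P Y : ComplexSpace} (π : P ⟶ Y)
                       (c : Fin k → ComplexSpace.Functions P (ComplexSpace.whole P)) : Set₁ where
  open ComplexSpace using (whole; Functions; 𝒪)
  field
    factor : ∀ {T} (u : T ⟶ Y) (f : Fin k → Functions T (whole T)) →
             Σ[ h ∈ T ⟶ P ] ((π ∘ₘ h ≃ u)
               × ∀ i → ⟦ pull h (whole P) (whole T) _ ⟧ (c i) ≈[ 𝒪 T (whole T) ] f i)
    unique : ∀ {T} (h h′ : T ⟶ P) → (π ∘ₘ h ≃ π ∘ₘ h′) →
             (∀ i → ⟦ pull h (whole P) (whole T) _ ⟧ (c i)
                      ≈[ 𝒪 T (whole T) ] ⟦ pull h′ (whole P) (whole T) _ ⟧ (c i)) →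
             h ≃ h′

-- Locally on the source, F is an open immersion into some Y × ℂ^k over Y.
IsSmooth : ∀ {X Y} → X ⟶ Y → Set₁
IsSmooth {X} {Y} F = ∀ x →
  Σ[ N ∈ ComplexSpace ] Σ[ u ∈ N ⟶ X ] (IsOpenImmersion u × (∃[ y ] (u $ y) ≈ₚ x)
    × Σ[ k ∈ ℕ ] Σ[ P ∈ ComplexSpace ] Σ[ π ∈ P ⟶ Y ] ((∃[ c ] IsProductWithℂ^ k π c)
    × Σ[ j ∈ N ⟶ P ] (IsOpenImmersion j × (π ∘ₘ j ≃ F ∘ₘ u))))
  where open ComplexSpace X using (_≈ₚ_)

record IsFibreProduct {P X Y Z} (p₁ : P ⟶ X) (p₂ : P ⟶ Y) (F : X ⟶ Z) (G : Y ⟶ Z) : Set₁ where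
  field
    commutes : F ∘ₘ p₁ ≃ G ∘ₘ p₂
    pair     : ∀ {T} (a : T ⟶ X) (b : T ⟶ Y) → F ∘ₘ a ≃ G ∘ₘ b → T ⟶ P
    pair₁    : ∀ {T} (a : T ⟶ X) (b : T ⟶ Y) q → p₁ ∘ₘ pair a b q ≃ a
    pair₂    : ∀ {T} (a : T ⟶ X) (b : T ⟶ Y) q → p₂ ∘ₘ pair a b q ≃ b
    unique   : ∀ {T} (h h′ : T ⟶ P) → p₁ ∘ₘ h ≃ p₁ ∘ₘ h′ → p₂ ∘ₘ h ≃ p₂ ∘ₘ h′ → h ≃ h′

-- An analytic stack, presented by a smooth groupoid s, t : Arr ⇉ Obj in complex
-- analytic spaces.  Orbifolds are the proper étale groupoids, a quotient Γ\D is
-- Γ × D ⇉ D, and a complex analytic space is the groupoid of identities (spaceAsStack).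
-- Comp is the space of pairs (a , b) with t a = s b; m (a , b) goes from s a to t b.
record AnalyticStack : Set₁ where
  field
    Obj Arr Comp : ComplexSpace
    s t          : Arr ⟶ Obj
    s-smooth     : IsSmooth s
    t-smooth     : IsSmooth t
    p₁ p₂ m      : Comp ⟶ Arr
    isComp       : IsFibreProduct p₁ p₂ t s
    e            : Obj ⟶ Arr
    inverse      : Arr ⟶ Arr
    s-m : s ∘ₘ m ≃ s ∘ₘ p₁
    t-m : t ∘ₘ m ≃ t ∘ₘ p₂
    s-e : s ∘ₘ e ≃ idₘ
    t-e : t ∘ₘ e ≃ idₘ
    s-inverse : s ∘ₘ inverse ≃ t
    t-inverse : t ∘ₘ inverse ≃ s

  mul : ∀ {T} (a b : T ⟶ Arr) → t ∘ₘ a ≃ s ∘ₘ b → T ⟶ Arr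
  mul a b q = m ∘ₘ IsFibreProduct.pair isComp a b q

  field
    assoc     : ∀ {T} (a b c : T ⟶ Arr) q q′ r r′ → mul (mul a b q) c r ≃ mul a (mul b c q′) r′
    identityˡ : ∀ {T} (a : T ⟶ Arr) q → mul (e ∘ₘ s ∘ₘ a) a q ≃ a
    identityʳ : ∀ {T} (a : T ⟶ Arr) q → mul a (e ∘ₘ t ∘ₘ a) q ≃ a
    inverseˡ  : ∀ {T} (a : T ⟶ Arr) q → mul (inverse ∘ₘ a) a q ≃ e ∘ₘ t ∘ₘ a
    inverseʳ  : ∀ {T} (a : T ⟶ Arr) q → mul a (inverse ∘ₘ a) q ≃ e ∘ₘ s ∘ₘ a

  module Obj = ComplexSpace Obj
  module Arr = ComplexSpace Arr
  module Comp = ComplexSpace Comp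

module _ {X Y : ComplexSpace} where
  private
    module X = ComplexSpace X
    module Y = ComplexSpace Y

  res-irrelevant : ∀ {U V} (i j : U X.⊆ V) s → ⟦ X.res U V i ⟧ s ≈[ X.𝒪 U ] ⟦ X.res U V j ⟧ s
  res-irrelevant {U} {V} i j s = 𝒪U.trans (𝒪U.sym (X.res-id U id _)) (X.res-∘ U U V id i j s)
    where module 𝒪U = ℂ-Algebra (X.𝒪 U)

  ≃-refl : (F : X ⟶ Y) → F ≃ F
  ≃-refl F = record { points = λ _ → Y.≈ₚ-refl ; functions = λ V N i j s → res-irrelevant i j _ }

  ≃-sym : {F G : X ⟶ Y} → F ≃ G → G ≃ F
  ≃-sym p = record
    { points = λ x → Y.≈ₚ-sym (points x)
    ; functions = λ V N i j s → ℂ-Algebra.sym (X.𝒪 N) (functions V N j i s) }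
    where open _≃_ p

  ≃-trans : {F G H : X ⟶ Y} → F ≃ G → G ≃ H → F ≃ H
  ≃-trans p q = record
    { points = λ x → Y.≈ₚ-trans (p.points x) (q.points x)
    ; functions = λ V N i j s → ℂ-Algebra.trans (X.𝒪 N)
        (p.functions V N i (λ {x} x∈N → Y.open-resp (Y.isOpen V) (p.points x) (i x∈N)) s)
        (q.functions V N _ j s) }
    where
      module p = _≃_ p
      module q = _≃_ q

  ≃-idˡ : (F : X ⟶ Y) → idₘ ∘ₘ F ≃ F
  ≃-idˡ F = record { points = λ _ → Y.≈ₚ-refl ; functions = λ V N i j s → res-irrelevant i j _ }

module _ {X : ComplexSpace} where
  open ComplexSpace X

  id-isOpenImmersion : IsOpenImmersion (idₘ {X})
  id-isOpenImmersion = record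
    { injective = id
    ; image-open = λ N → open-ext (λ x x∈N → x , x∈N , ≈ₚ-refl) (λ y → image⊆ N) (isOpen N)
    ; ♯-injective = λ N s t eq → let open ℂ-Algebra (𝒪 (img N)) in
        trans (sym (back N s)) (trans (AlgHom.⟦⟧-cong (res (img N) N (image⊆ N)) eq) (back N t))
    ; ♯-surjective = λ N t → ⟦ res (img N) N (image⊆ N) ⟧ t
        , ℂ-Algebra.trans (𝒪 N) (res-∘ N (img N) N (⊆img N) (image⊆ N) id t) (res-id N id t) }
    where
      image⊆ : ∀ N {y} → ∃[ x ] (N ∋ x × x ≈ₚ y) → N ∋ y
      image⊆ N (_ , x∈N , x≈y) = open-resp (isOpen N) x≈y x∈N
      img : Open → Open
      img N = mkOpen _ (open-ext {U = N ∋_} (λ x x∈N → x , x∈N , ≈ₚ-refl) (λ y → image⊆ N) (isOpen N))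
      ⊆img : ∀ N → N ⊆ img N
      ⊆img N p = _ , p , ≈ₚ-refl
      back : ∀ N s → ⟦ res (img N) N (image⊆ N) ⟧ (⟦ res N (img N) (⊆img N) ⟧ s) ≈[ 𝒪 (img N) ] s
      back N s = ℂ-Algebra.trans (𝒪 (img N))
        (res-∘ (img N) N (img N) (image⊆ N) (⊆img N) id s) (res-id (img N) id s)

  id-isSmooth : IsSmooth (idₘ {X})
  id-isSmooth x = X , idₘ , id-isOpenImmersion , (x , ≈ₚ-refl)
    , 0 , X , idₘ , ((λ ()) , record
        { factor = λ u f → u , ≃-idˡ u , λ ()
        ; unique = λ h h′ p _ → ≃-trans (≃-sym (≃-idˡ h)) (≃-trans p (≃-idˡ h′)) })
    , idₘ , id-isOpenImmersion , ≃-refl (idₘ ∘ₘ idₘ)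

spaceAsStack : ComplexSpace → AnalyticStack
spaceAsStack X = record
  { Obj = X ; Arr = X ; Comp = X
  ; s = idₘ ; t = idₘ ; s-smooth = id-isSmooth ; t-smooth = id-isSmooth
  ; p₁ = idₘ ; p₂ = idₘ ; m = idₘ ; e = idₘ ; inverse = idₘ
  ; isComp = record
      { commutes = ≃-idid
      ; pair = λ a b q → a
      ; pair₁ = λ a b q → ≃-idˡ a
      ; pair₂ = λ a b q → ≃-trans q (≃-idˡ b)
      ; unique = λ h h′ p _ → ≃-trans (≃-sym (≃-idˡ h)) (≃-trans p (≃-idˡ h′)) }
  ; s-m = ≃-idid ; t-m = ≃-idid
  ; s-e = ≃-idˡ idₘ ; t-e = ≃-idˡ idₘ ; s-inverse = ≃-idˡ idₘ ; t-inverse = ≃-idˡ idₘ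
  ; assoc = λ a b c q q′ r r′ → ≃-idˡ (idₘ ∘ₘ a)
  ; identityˡ = λ a q → ≃-trans (≃-idˡ (idₘ ∘ₘ idₘ ∘ₘ a)) (≃-trans (≃-idˡ (idₘ ∘ₘ a)) (≃-idˡ a))
  ; identityʳ = λ a q → ≃-idˡ a
  ; inverseˡ = λ a q → ≃-refl (idₘ ∘ₘ idₘ ∘ₘ a)
  ; inverseʳ = λ a q → ≃-sym (≃-idˡ (idₘ ∘ₘ a)) }
  where
    ≃-idid : idₘ ∘ₘ idₘ ≃ idₘ ∘ₘ idₘ {X}
    ≃-idid = ≃-refl (idₘ ∘ₘ idₘ)

-- A vector bundle on the stack Arr ⇉ Obj: an open cover U of Obj trivialising it
-- and its transition functions.  At an arrow from x ∈ U i to y ∈ U j, θ i j takes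
-- coordinates of the fibre at y in the j-th frame to coordinates of the fibre at
-- x in the i-th frame.  On a complex analytic space these are the usual
-- transition functions on U i ∩ U j.
record VectorBundle (X : AnalyticStack) (r : ℕ) : Set₁ where
  open AnalyticStack X
  field
    Index  : Set
    U      : Index → Obj.Open
    covers : ∀ x → ∃[ i ] U i Obj.∋ x

  U₂ : Index → Index → Arr.Open
  U₂ i j = preimage s (U i) Arr.∩ preimage t (U j)

  U₃ : Index → Index → Index → Comp.Open
  U₃ i j k = preimage p₁ (U₂ i j) Comp.∩ preimage p₂ (U₂ j k)

  U₃⊆ : ∀ i j k → U₃ i j k Comp.⊆ preimage m (U₂ i k)
  U₃⊆ i j k {x} ((sx∈Ui , _) , (_ , tx∈Uk)) =
      Obj.open-resp (Obj.isOpen (U i)) (Obj.≈ₚ-sym (_≃_.points s-m x)) sx∈Ui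
    , Obj.open-resp (Obj.isOpen (U k)) (Obj.≈ₚ-sym (_≃_.points t-m x)) tx∈Uk

  field
    θ       : ∀ i j → GL r (Arr.𝒪 (U₂ i j))
    cocycle : ∀ i j k → let open Matrices (Comp.𝒪 (U₃ i j k)) in
      mat (mapGL (pull m (U₂ i k) (U₃ i j k) (U₃⊆ i j k)) (θ i k))
        ≈ᵐ mat (mapGL (pull p₁ (U₂ i j) (U₃ i j k) proj₁) (θ i j)
                ∙ mapGL (pull p₂ (U₂ j k) (U₃ i j k) proj₂) (θ j k))

-- 𝔼 ⟨ V ⟩ is 𝔼_ρ, for V of highest weight ρ: the bundle with fibre V associated
-- with the frame bundle of 𝔼.
infix 8 _⟨_⟩
_⟨_⟩ : ∀ {X g} → VectorBundle X g → (V : Rep g) → VectorBundle X (dim V)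
_⟨_⟩ {X} {g} 𝔼 V = record
  { Index = Index ; U = U ; covers = covers
  ; θ = λ i j → act V (θ i j)
  ; cocycle = λ i j k →
      let N = U₃ i j k
          h = pull m (U₂ i k) N (U₃⊆ i j k)
          h₁ = pull p₁ (U₂ i j) N proj₁
          h₂ = pull p₂ (U₂ j k) N proj₂
          open Matrices (AnalyticStack.Comp.𝒪 X N)
      in ≈ᵐ-trans (≈ᵐ-sym (Rep.natural V h (θ i k)))
         (≈ᵐ-trans (Rep.cong V {γ = mapGL h (θ i k)} {η = mapGL h₁ (θ i j) ∙ mapGL h₂ (θ j k)} (cocycle i j k))
         (≈ᵐ-trans (Rep.homo V (mapGL h₁ (θ i j)) (mapGL h₂ (θ j k)))
           (·-cong (Rep.natural V h₁ (θ i j)) (Rep.natural V h₂ (θ j k))))) }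
  where
    open AnalyticStack X
    open VectorBundle 𝔼

module _ {X : AnalyticStack} {r : ℕ} (B : VectorBundle X r) where
  open AnalyticStack X
  open VectorBundle B

  LocalSections : Set
  LocalSections = ∀ i → Fin r → Obj.Functions (U i)

  -- The local sections agree on overlaps: s^*f_i = θ_ij t^*f_j.
  IsSection : LocalSections → Set
  IsSection f = ∀ i j → let open Matrices (Arr.𝒪 (U₂ i j)) in
    (λ a → ⟦ pull s (U i) (U₂ i j) proj₁ ⟧ (f i a))
      ≈ᵛ mat (θ i j) ·ᵥ (λ a → ⟦ pull t (U j) (U₂ i j) proj₂ ⟧ (f j a))

module _ {X : AnalyticStack} {g : ℕ} (𝔼 : VectorBundle X g) where
  open AnalyticStack X

  IsModularForm : (V : Rep g) → LocalSections (𝔼 ⟨ V ⟩) → Set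
  IsModularForm V = IsSection (𝔼 ⟨ V ⟩)

  ModularForm : Rep g → Set
  ModularForm V = Σ[ f ∈ LocalSections (𝔼 ⟨ V ⟩) ] IsModularForm V f

  -- f^d, in the trivialisation of Sym^d(𝔼_ρ) over U i.
  symPower : ∀ d (V : Rep g) → ModularForm V → ∀ i →
             Module.Carrierᴹ (SymFree (Obj.𝒪 (VectorBundle.U 𝔼 i)) d (dim V))
  symPower d V (f , _) i = SymmetricPower.power (FreeModule (Obj.𝒪 (VectorBundle.U 𝔼 i)) (dim V)) d (f i)

  -- The image of f^d under the bundle map Sym^d(𝔼_ρ) → 𝔼_σ induced by p.
  applyConcomitant : ∀ {d V W} {I : Concomitant d V W} → Projection d V W I →
                     ModularForm V → LocalSections (𝔼 ⟨ W ⟩)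
  applyConcomitant {d} {V} π f i =
    extendFromSym (Obj.𝒪 (VectorBundle.U 𝔼 i)) d (Projection.p π) (symPower d V f i)

{-# OPTIONS --safe #-}
-- In local frames the section condition reads s^*f_i = ρ(θ_ij) t^*f_j.  Expanding d-th powers in
-- coordinates commutes with pullback of functions, since p has constant coefficients;
-- so s^*(p f_i^d) = p ((ρ(θ_ij) t^*f_j)^d), and equivariance of p, applied over the ring of
-- functions on the overlap, turns this into σ(θ_ij) t^*(p f_j^d).
module Submission where

open import Defs
open import Data.Fin.Base using (Fin; zero; suc)
open import Data.List.Base as List using ([]; _∷_)
open import Data.Nat.Base using (ℕ; zero; suc)
open import Data.Product using (_,_; proj₁; proj₂)
import Data.Vec.Functional as Vector
open import Function.Base using (_∘_)
import Algebra.Properties.CommutativeMonoid.Sum as CommutativeMonoidSum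

module _ (A : ℂ-Algebra) (d : ℕ) where
  open ℂ-Algebra A
  open Matrices A

  ∑tuples-cong : ∀ e {n} {f g : (Fin e → Fin n) → Carrier} → (∀ J → f J ≈ g J) →
                 ∑tuples A d e f ≈ ∑tuples A d e g
  ∑tuples-cong zero    p = p (λ ())
  ∑tuples-cong (suc e) p = sum-cong-≋ (λ j → ∑tuples-cong e (λ J → p (j Vector.∷ J)))

  product-cong : ∀ {e} {f g : Fin e → Carrier} → (∀ k → f k ≈ g k) → product f ≈ product g
  product-cong = CommutativeMonoidSum.sum-cong-≋ *-commutativeMonoid

  -- The vectors of a term enter only through products of their coordinates, while `p` is evaluated
  -- only at monomials in the standard basis.
  extendFromSym-term-cong : ∀ {m n} p r {v w : Fin d → Vec n} → (∀ k → v k ≈ᵛ w k) →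
    extendFromSym A d {m} p ((r , v) ∷ []) ≈ᵛ extendFromSym A d p ((r , w) ∷ [])
  extendFromSym-term-cong p r v≈w i =
    +-congʳ (∑tuples-cong d (λ J → *-congʳ (*-congˡ (product-cong (λ k → v≈w k (J k))))))

module _ {A B : ℂ-Algebra} (h : AlgHom A B) (d : ℕ) where
  private
    module A = ℂ-Algebra A
    module B = ℂ-Algebra B
    module h = AlgHom h

  ∑tuples-homo : ∀ e {n} (f : (Fin e → Fin n) → A.Carrier) →
                 ⟦ h ⟧ (∑tuples A d e f) B.≈ ∑tuples B d e (⟦ h ⟧ ∘ f)
  ∑tuples-homo zero    f = B.refl
  ∑tuples-homo (suc e) f = B.trans (sum-homo h (λ j → ∑tuples A d e (λ J → f (j Vector.∷ J))))
    (B.sum-cong-≋ (λ j → ∑tuples-homo e (λ J → f (j Vector.∷ J))))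

  product-homo : ∀ {e} (f : Fin e → A.Carrier) → ⟦ h ⟧ (A.product f) B.≈ B.product (⟦ h ⟧ ∘ f)
  product-homo {zero}  f = h.1#-homo
  product-homo {suc e} f = B.trans (h.*-homo _ _) (B.*-congˡ (product-homo (f ∘ suc)))

  -- The values of `p` at basis monomials are complex numbers, embedded by `ι`, so `h.ι-comm`
  -- carries them across; the rest is sums and products, which `h` preserves.
  extendFromSym-natural : ∀ {m n} p (x : SymmetricPower.FormalSum (FreeModule A n) d) (i : Fin m) →
    ⟦ h ⟧ (extendFromSym A d p x i)
      B.≈ extendFromSym B d p (List.map (λ (r , v) → ⟦ h ⟧ r , λ k → ⟦ h ⟧ ∘ v k) x) i
  extendFromSym-natural p []            i = h.0#-homo
  extendFromSym-natural p ((r , v) ∷ x) i = B.trans (h.+-homo _ _) (B.+-cong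
    (B.trans (∑tuples-homo d _) (∑tuples-cong B d d (λ J → B.trans (h.*-homo _ _)
      (B.*-cong (B.trans (h.*-homo _ _) (B.*-congˡ (product-homo (λ k → v k (J k))))) (h.ι-comm _)))))
    (extendFromSym-natural p x i))

  extendFromSym-power-natural : ∀ {m n} p (v : Fin n → A.Carrier) (i : Fin m) →
    ⟦ h ⟧ (extendFromSym A d p (SymmetricPower.power (FreeModule A n) d v) i)
      B.≈ extendFromSym B d p (SymmetricPower.power (FreeModule B n) d (⟦ h ⟧ ∘ v)) i
  extendFromSym-power-natural p v i = B.trans (extendFromSym-natural p (SymmetricPower.power (FreeModule A _) d v) i)
    -- Mapping the power termwise leaves the coefficient `⟦ h ⟧ 1#`, which is replaced by `1#` here.
    (B.+-congʳ (∑tuples-cong B d d (λ J → B.*-congʳ (B.*-congʳ h.1#-homo))))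

mainTheorem2 : ∀ (X : AnalyticStack) (g : ℕ) (𝔼 : VectorBundle X g)
    (ρ σ : Weight g) (V W : Rep g) →
    IsIrreducible V → HasHighestWeight V ρ →
    IsIrreducible W → HasHighestWeight W σ →
    (f : ModularForm 𝔼 V) (d : ℕ) (I : Concomitant d V W) (π : Projection d V W I) →
    IsModularForm 𝔼 W (applyConcomitant 𝔼 π f)
mainTheorem2 X g 𝔼 ρ σ V W _ _ _ _ (f , f-section) d I π i j a = begin
    ⟦ s* ⟧ (applyConcomitant 𝔼 π (f , f-section) i a)
      ≈⟨ extendFromSym-power-natural s* d p (f i) a ⟩
    extendFromSym N d p (SymmetricPower.power (FreeModule N (dim V)) d (⟦ s* ⟧ ∘ f i)) a
      -- The section condition is substituted in each of the `d` equal factors; the result is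
      -- `symMap` of a power by definition.
      ≈⟨ extendFromSym-term-cong N d p 1# (λ _ → f-section i j) a ⟩
    extendFromSym N d p (symMap N d (mat (act V (θ i j)))
        (SymmetricPower.power (FreeModule N (dim V)) d (⟦ t* ⟧ ∘ f j))) a
      -- The entries of `θ i j` are functions on the overlap, so equivariance is used at an
      -- `N`-valued point of GL(g), not a complex one.
      ≈⟨ equivariant N (θ i j) (SymmetricPower.power (FreeModule N (dim V)) d (⟦ t* ⟧ ∘ f j)) a ⟩
    (mat (act W (θ i j)) ·ᵥ extendFromSym N d p
        (SymmetricPower.power (FreeModule N (dim V)) d (⟦ t* ⟧ ∘ f j))) a
      -- Naturality for `t*`, read backwards, in each coordinate `b` under the matrix product.
      ≈⟨ sum-cong-≋ (λ b → *-congˡ (extendFromSym-power-natural t* d p (f j) b)) ⟨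
    (mat (act W (θ i j)) ·ᵥ (λ b → ⟦ t* ⟧ (applyConcomitant 𝔼 π (f , f-section) j b))) a ∎
  where
    open AnalyticStack X
    open VectorBundle 𝔼
    open Projection π using (p; equivariant)
    N : ℂ-Algebra
    N = Arr.𝒪 (U₂ i j)
    open ℂ-Algebra N
    open Matrices N using (_·ᵥ_)
    open import Relation.Binary.Reasoning.Setoid setoid
    s* = pull s (U i) (U₂ i j) proj₁
    t* = pull t (U j) (U₂ i j) proj₂
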